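{- For every integer $m\ge 3$ there exists a nested $\mathrm{SQS}(2^m)$ whose underlying SQS is the Boolean $\mathrm{SQS}(2^m)$, which is completely uniform when $m$ is odd and completely quasi-uniform when $m$ is even.
   Context: An $\mathrm{SQS}(v)$ is a pair $(V,\mathcal{B})$ with $|V|=v$ and $\mathcal{B}$ a set of $4$-subsets such that every $3$-subset of $V$ lies in exactly one block. The Boolean $\mathrm{SQS}(2^m)$ has point set $\mathbb{F}_2^m$ and blocks all $4$-sets $\{x,y,z,x+y+z\}$ with $x,y,z$ distinct. A nested $\mathrm{SQS}(v)$ is a pair $(V,\mathscr{B})$ where each element of $\mathscr{B}$ is a partition $\{x,y\mid z,w\}=\{\{x,y\},\{z,w\}\}$ of a $4$-set into two pairs, such that $(V,\{\{x,y,z,w\}:\{x,y\mid z,w\}\in\mathscr{B}\})$ is an $\mathrm{SQS}(v)$ (its underlying SQS); each block is partitioned once. The multiplicity of a pair $\{x,y\}\in\binom{V}{2}$ is the number of elements of $\mathscr{B}$ having $\{x,y\}$ as one of their two parts. The nested SQS is completely uniform if all pairs in $\binom{V}{2}$ have the same positive multiplicity; it is completely quasi-uniform if all pairs in $\binom{V}{2}$ have positive multiplicity, any two multiplicities differ by at most one, and not all multiplicities are equal. -}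

module Defs where

open import Data.Bool using (Bool; _xor_)
open import Data.Nat using (ℕ; zero; suc; _≤_; _<_; _%_)
open import Data.Vec using (Vec; zipWith)
open import Data.List using (List; length; filter)
open import Data.Product using (_×_; Σ; ∃; ∃-syntax; _,_)
open import Data.Sum using (_⊎_)
open import Function.Bundles using (_⇔_)
open import Relation.Nullary using (¬_)
open import Relation.Nullary.Decidable using (_×-dec_; _⊎-dec_)
open import Relation.Unary using (Decidable)
open import Relation.Binary.PropositionalEquality using (_≡_; _≢_)
import Data.Vec.Properties as VecP
import Data.Bool.Properties as BoolP

-- Points of F₂^m : bit vectors of length m, addition = coordinatewise xor.
Point : ℕ → Set
Point m = Vec Bool m

_⊕_ : ∀ {m} → Point m → Point m → Point m
_⊕_ = zipWith _xor_

_≟ₚ_ : ∀ {m} (x y : Point m) → Relation.Nullary.Dec (x ≡ y)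
_≟ₚ_ = VecP.≡-dec BoolP._≟_

-- A nested block  {a,b | c,d}  : a 4-set {a,b,c,d} partitioned into the
-- pairs {a,b} and {c,d}.
record NBlock (m : ℕ) : Set where
  constructor ⟨_,_∣_,_⟩
  field
    a b c d : Point m
open NBlock public

_∈B_ : ∀ {m} → Point m → NBlock m → Set
x ∈B B = x ≡ a B ⊎ x ≡ b B ⊎ x ≡ c B ⊎ x ≡ d B

IsFourSet : ∀ {m} → NBlock m → Set
IsFourSet B = a B ≢ b B × a B ≢ c B × a B ≢ d B
            × b B ≢ c B × b B ≢ d B × c B ≢ d B

Distinct3 : ∀ {m} → Point m → Point m → Point m → Set
Distinct3 x y z = x ≢ y × x ≢ z × y ≢ z

contains3? : ∀ {m} (x y z : Point m) → Decidable (λ (B : NBlock m) → x ∈B B × y ∈B B × z ∈B B)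
contains3? x y z B = mem x ×-dec (mem y ×-dec mem z)
  where
  mem : ∀ w → Relation.Nullary.Dec (w ∈B B)
  mem w = (w ≟ₚ a B) ⊎-dec ((w ≟ₚ b B) ⊎-dec ((w ≟ₚ c B) ⊎-dec (w ≟ₚ d B)))

SamePair : ∀ {m} → Point m → Point m → Point m → Point m → Set
SamePair x y u v = (x ≡ u × y ≡ v) ⊎ (x ≡ v × y ≡ u)

samePair? : ∀ {m} (x y u v : Point m) → Relation.Nullary.Dec (SamePair x y u v)
samePair? x y u v = ((x ≟ₚ u) ×-dec (y ≟ₚ v)) ⊎-dec ((x ≟ₚ v) ×-dec (y ≟ₚ u))

hasPart? : ∀ {m} (x y : Point m) → Decidable (λ (B : NBlock m) → SamePair x y (a B) (b B) ⊎ SamePair x y (c B) (d B))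
hasPart? x y B = samePair? x y (a B) (b B) ⊎-dec samePair? x y (c B) (d B)

-- A nested SQS on F₂^m, given as a list of nested blocks (the list plays the
-- role of the set 𝓑; the "exactly one" condition forces the underlying
-- 4-sets, hence the list entries, to be pairwise distinct).
IsNestedSQS : ∀ {m} → List (NBlock m) → Set
IsNestedSQS {m} 𝓑 =
  (∀ B → B Data.List.Membership.Propositional.∈ 𝓑 → IsFourSet B)
  × (∀ (x y z : Point m) → Distinct3 x y z → length (filter (contains3? x y z) 𝓑) ≡ 1)
  where import Data.List.Membership.Propositional

SameSet : ∀ {m} → NBlock m → Point m → Point m → Point m → Point m → Set
SameSet {m} B p q r s = ∀ (w : Point m) → (w ∈B B) ⇔ (w ≡ p ⊎ w ≡ q ⊎ w ≡ r ⊎ w ≡ s)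

UnderlyingIsBoolean : ∀ {m} → List (NBlock m) → Set
UnderlyingIsBoolean {m} 𝓑 =
  (∀ B → B ∈ 𝓑 → ∃[ x ] ∃[ y ] ∃[ z ] (Distinct3 x y z × SameSet B x y z ((x ⊕ y) ⊕ z)))
  × (∀ (x y z : Point m) → Distinct3 x y z →
       ∃[ B ] (B ∈ 𝓑 × SameSet B x y z ((x ⊕ y) ⊕ z)))
  where open import Data.List.Membership.Propositional using (_∈_)

multiplicity : ∀ {m} → List (NBlock m) → Point m → Point m → ℕ
multiplicity 𝓑 x y = length (filter (hasPart? x y) 𝓑)

CompletelyUniform : ∀ {m} → List (NBlock m) → Set
CompletelyUniform {m} 𝓑 =
  ∃[ k ] (1 ≤ k × (∀ (x y : Point m) → x ≢ y → multiplicity 𝓑 x y ≡ k))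

CompletelyQuasiUniform : ∀ {m} → List (NBlock m) → Set
CompletelyQuasiUniform {m} 𝓑 =
  (∀ (x y : Point m) → x ≢ y → 1 ≤ multiplicity 𝓑 x y)
  × (∀ (x y u v : Point m) → x ≢ y → u ≢ v →
       multiplicity 𝓑 x y ≤ suc (multiplicity 𝓑 u v))
  × (∃[ x ] ∃[ y ] ∃[ u ] ∃[ v ] (x ≢ y × u ≢ v × multiplicity 𝓑 x y ≢ multiplicity 𝓑 u v))

{-# OPTIONS --safe #-}
module Submission where

-- Let the way a block {x, y, z, x+y+z} is split depend only on its plane of
-- directions {0, p, q, p+q}: choosing p there means that the parts are the pairs
-- with difference p.  Such a rule assigns each line of PG(m-1,2) to one of its
-- points, and the multiplicity of {x, y} is the number of lines assigned to x+y.
-- So it suffices to find assignments whose loads all lie in {k, k+ε}, both ends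
-- being attained, where ε = 0 for odd and ε = 1 for even m.
--
-- They are built by recursion from V = F₂^m to F₂² × V, starting at m = 2, 3.
-- Put |V| = 2h, so that h = 3k+1+ε; loads in {k, k+ε} become loads in
-- {h+k, h+k+ε}.  Lines inside V keep their point.  A line {(0,0,a), (1,0,x),
-- (1,0,x+a)} goes to (0,0,a), which adds h to the load of a.  The lines that meet
-- V in a point and otherwise lie on level (0,1), or on level (1,1), are edges of
-- the complete graph on V and are oriented by a tournament with scores h-1 and h.
-- The remaining lines {(0,1,y), (1,0,y+z), (1,1,z)} are the cells of a Latin
-- square.  Sorting them by the orthogonal mate y+Az, where A and I+A are
-- invertible, gives k values to the rows, k to the columns, h+k+ε to the symbols,
-- and the cells of the last value go to the rows and columns of score h-1.

open import Defs
open import Algebra.Bundles using (CommutativeMonoid; CommutativeRing)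
open import Data.Bool using (Bool; true; false; not; _∧_; _∨_; _xor_; if_then_else_)
import Data.Bool as Bool
open import Data.Bool.Properties using (not-involutive; xor-same; xor-comm; xor-identityʳ; xor-∧-commutativeRing)
open import Data.Empty using (⊥; ⊥-elim)
open import Data.Fin using (Fin; zero; suc)
open import Data.List using (List; []; _∷_; map; _++_; filter; length; cartesianProduct)
open import Data.List.Properties using (length-map; length-++; filter-++; filter-≐)
open import Data.List.Membership.Propositional using (_∈_)
open import Data.List.Membership.Propositional.Properties using (∈-map⁺; ∈-map⁻; ∈-++⁺ˡ; ∈-++⁺ʳ; ∈-filter⁺; ∈-filter⁻; ∈-cartesianProduct⁺)
open import Data.List.Membership.Propositional.Properties.WithK using (unique∧set⇒bag)
open import Data.List.Relation.Binary.BagAndSetEquality using (∼bag⇒↭)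
open import Data.List.Relation.Binary.Permutation.Propositional.Properties using (↭-length)
open import Data.List.Relation.Unary.All using ([])
open import Data.List.Relation.Unary.AllPairs using ([]; _∷_)
open import Data.List.Relation.Unary.Any using (here)
open import Data.List.Relation.Unary.Unique.Propositional using (Unique)
import Data.List.Relation.Unary.Unique.Propositional.Properties as Unique
open import Data.Nat using (ℕ; zero; suc; _+_; _≤_; _%_; _≤?_; z≤n; s≤s)
open import Data.Nat.Properties hiding (_≤?_)
open import Data.Nat.Tactic.RingSolver using (solve-∀)
open import Data.Product using (_×_; _,_; proj₁; proj₂; ∃-syntax)
open import Data.Sum using (_⊎_; inj₁; inj₂; swap)
open import Data.Vec using (Vec; []; _∷_; lookup; replicate)
open import Data.Vec.Properties using (∷-injectiveʳ)
open import Function using (_∘_; _⇔_; mk⇔; Equivalence)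
open import Relation.Nullary using (Dec; yes; no; does; ¬?)
open import Relation.Nullary.Decidable using (map′; from-yes; _×-dec_; _⊎-dec_; _→-dec_)
open import Relation.Unary using (Decidable)
open import Relation.Binary.PropositionalEquality

-- Linear algebra over F₂

𝟎 : ∀ {m} → Point m
𝟎 = replicate _ false

⊕-identityˡ : ∀ {m} (x : Point m) → 𝟎 ⊕ x ≡ x
⊕-identityˡ []      = refl
⊕-identityˡ (b ∷ x) = cong (b ∷_) (⊕-identityˡ x)

_·_ : ∀ {m} → Bool → Point m → Point m
true  · x = x
false · x = 𝟎

lin : ∀ {n m} → Vec Bool n → Vec (Point m) n → Point m
lin []      []      = 𝟎
lin (α ∷ c) (x ∷ ρ) = (α · x) ⊕ lin c ρ

lin-zero : ∀ {n m} (ρ : Vec (Point m) n) → lin 𝟎 ρ ≡ 𝟎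
lin-zero []      = refl
lin-zero (x ∷ ρ) = trans (⊕-identityˡ _) (lin-zero ρ)

xor-interchange : ∀ a b c d → (a xor b) xor (c xor d) ≡ (a xor c) xor (b xor d)
xor-interchange = interchange
  where
  open CommutativeRing xor-∧-commutativeRing using (+-commutativeMonoid)
  open CommutativeMonoid +-commutativeMonoid using (commutativeSemigroup)
  open import Algebra.Properties.CommutativeSemigroup commutativeSemigroup using (interchange)

⊕-interchange : ∀ {m} (x y u v : Point m) → (x ⊕ y) ⊕ (u ⊕ v) ≡ (x ⊕ u) ⊕ (y ⊕ v)
⊕-interchange []      []      []      []      = refl
⊕-interchange (a ∷ x) (b ∷ y) (c ∷ u) (d ∷ v) =
  cong₂ _∷_ (xor-interchange a b c d) (⊕-interchange x y u v)

⊕-identityʳ : ∀ {m} (x : Point m) → x ⊕ 𝟎 ≡ x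
⊕-identityʳ []      = refl
⊕-identityʳ (b ∷ x) = cong₂ _∷_ (xor-identityʳ b) (⊕-identityʳ x)

⊕-self : ∀ {m} (x : Point m) → x ⊕ x ≡ 𝟎
⊕-self []      = refl
⊕-self (b ∷ x) = cong₂ _∷_ (xor-same b) (⊕-self x)

·-distrib-xor : ∀ {m} α β (x : Point m) → (α xor β) · x ≡ (α · x) ⊕ (β · x)
·-distrib-xor true  true  x = sym (⊕-self x)
·-distrib-xor true  false x = sym (⊕-identityʳ x)
·-distrib-xor false β     x = sym (⊕-identityˡ (β · x))

lin-⊕ : ∀ {n m} (c d : Vec Bool n) (ρ : Vec (Point m) n) →
        lin (c ⊕ d) ρ ≡ lin c ρ ⊕ lin d ρ
lin-⊕ []      []      []      = sym (⊕-identityˡ 𝟎)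
lin-⊕ (α ∷ c) (β ∷ d) (x ∷ ρ) =
  trans (cong₂ _⊕_ (·-distrib-xor α β x) (lin-⊕ c d ρ))
        (⊕-interchange (α · x) (β · x) (lin c ρ) (lin d ρ))

data Expr (n : ℕ) : Set where
  var : Fin n → Expr n
  :0  : Expr n
  _:+_ : Expr n → Expr n → Expr n

infixl 6 _:+_

⟦_⟧ : ∀ {n m} → Expr n → Vec (Point m) n → Point m
⟦ var i ⟧  ρ = lookup ρ i
⟦ :0 ⟧     ρ = 𝟎
⟦ e :+ f ⟧ ρ = ⟦ e ⟧ ρ ⊕ ⟦ f ⟧ ρ

unit : ∀ {n} → Fin n → Vec Bool n
unit zero    = true ∷ 𝟎
unit (suc i) = false ∷ unit i

coeffs : ∀ {n} → Expr n → Vec Bool n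
coeffs (var i)  = unit i
coeffs :0       = 𝟎
coeffs (e :+ f) = coeffs e ⊕ coeffs f

lin-unit : ∀ {n m} (i : Fin n) (ρ : Vec (Point m) n) → lin (unit i) ρ ≡ lookup ρ i
lin-unit zero    (x ∷ ρ) = trans (cong (x ⊕_) (lin-zero ρ)) (⊕-identityʳ x)
lin-unit (suc i) (x ∷ ρ) = trans (⊕-identityˡ _) (lin-unit i ρ)

coeffs-sound : ∀ {n m} (e : Expr n) (ρ : Vec (Point m) n) → lin (coeffs e) ρ ≡ ⟦ e ⟧ ρ
coeffs-sound (var i)  ρ = lin-unit i ρ
coeffs-sound :0       ρ = lin-zero ρ
coeffs-sound (e :+ f) ρ =
  trans (lin-⊕ (coeffs e) (coeffs f) ρ) (cong₂ _⊕_ (coeffs-sound e ρ) (coeffs-sound f ρ))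

-- Both expressions denote the linear combination with the coefficients `coeffs`, so an identity
-- between sums of vectors over F₂ is settled by evaluation and its proof can be given as `refl`.
⊕-solve : ∀ {n m} (ρ : Vec (Point m) n) (e f : Expr n) → coeffs e ≡ coeffs f → ⟦ e ⟧ ρ ≡ ⟦ f ⟧ ρ
⊕-solve ρ e f eq = trans (sym (coeffs-sound e ρ)) (trans (cong (λ c → lin c ρ) eq) (coeffs-sound f ρ))

pattern 𝕒 = var zero
pattern 𝕓 = var (suc zero)
pattern 𝕔 = var (suc (suc zero))

⊕-comm : ∀ {m} (x y : Point m) → x ⊕ y ≡ y ⊕ x
⊕-comm x y = ⊕-solve (x ∷ y ∷ []) (𝕒 :+ 𝕓) (𝕓 :+ 𝕒) refl

⊕-cancelˡ : ∀ {m} (x y : Point m) → x ⊕ (x ⊕ y) ≡ y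
⊕-cancelˡ x y = ⊕-solve (x ∷ y ∷ []) (𝕒 :+ (𝕒 :+ 𝕓)) 𝕓 refl

⊕-cancelʳ : ∀ {m} (x y : Point m) → (x ⊕ y) ⊕ y ≡ x
⊕-cancelʳ x y = ⊕-solve (x ∷ y ∷ []) ((𝕒 :+ 𝕓) :+ 𝕓) 𝕒 refl

⊕-cancel-outer : ∀ {m} (x y : Point m) → (x ⊕ y) ⊕ x ≡ y
⊕-cancel-outer x y = ⊕-solve (x ∷ y ∷ []) ((𝕒 :+ 𝕓) :+ 𝕒) 𝕓 refl

⊕≡𝟎⇒≡ : ∀ {m} (x y : Point m) → x ⊕ y ≡ 𝟎 → x ≡ y
⊕≡𝟎⇒≡ x y eq = trans (sym (⊕-cancelʳ x y))
                     (trans (cong (_⊕ y) eq) (⊕-identityˡ y))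

-- Counting points

𝟙 : Bool → ℕ
𝟙 true  = 1
𝟙 false = 0

count : ∀ {m} → (Point m → Bool) → ℕ
count {zero}  f = 𝟙 (f [])
count {suc m} f = count (f ∘ (false ∷_)) + count (f ∘ (true ∷_))

-- This is 2^m, written as a sum so that it unfolds together with `count`.
size : ℕ → ℕ
size zero    = 1
size (suc m) = size m + size m

count-cong : ∀ {m} {f g : Point m → Bool} → (∀ x → f x ≡ g x) → count f ≡ count g
count-cong {zero}  eq = cong 𝟙 (eq [])
count-cong {suc m} eq = cong₂ _+_ (count-cong (eq ∘ (false ∷_))) (count-cong (eq ∘ (true ∷_)))

count-false : ∀ m → count {m} (λ _ → false) ≡ 0
count-false zero    = refl
count-false (suc m) = cong₂ _+_ (count-false m) (count-false m)

count-true : ∀ m → count {m} (λ _ → true) ≡ size m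
count-true zero    = refl
count-true (suc m) = cong₂ _+_ (count-true m) (count-true m)

count-translate : ∀ {m} (c : Point m) (f : Point m → Bool) → count (λ x → f (c ⊕ x)) ≡ count f
count-translate []          f = refl
count-translate (false ∷ c) f =
  cong₂ _+_ (count-translate c (f ∘ (false ∷_))) (count-translate c (f ∘ (true ∷_)))
count-translate (true ∷ c)  f =
  trans (cong₂ _+_ (count-translate c (f ∘ (true ∷_))) (count-translate c (f ∘ (false ∷_))))
        (+-comm (count (f ∘ (true ∷_))) _)

count-split : ∀ {m} (f g : Point m → Bool) →
              count (λ x → f x ∧ g x) + count (λ x → f x ∧ not (g x)) ≡ count f
count-split {zero}  f g with f [] | g []
... | false | _     = refl
... | true  | true  = refl
... | true  | false = refl
count-split {suc m} f g =
  trans (lemma (count (λ x → f (false ∷ x) ∧ g (false ∷ x))) _ _ _)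
        (cong₂ _+_ (count-split (f ∘ (false ∷_)) (g ∘ (false ∷_)))
                   (count-split (f ∘ (true ∷_)) (g ∘ (true ∷_))))
  where
  lemma : ∀ a b c d → (a + b) + (c + d) ≡ (a + c) + (b + d)
  lemma = solve-∀

-- The binary value, first coordinate most significant. It numbers the points from 0 to 2^m - 1, so
-- that classes of prescribed sizes can be cut out as intervals.
val : ∀ {m} → Point m → ℕ
val []                    = 0
val (false ∷ x)           = val x
val {suc m} (true  ∷ x)   = size m + val x

countBelow : ℕ → (ℕ → Bool) → ℕ
countBelow zero    p = 0
countBelow (suc n) p = 𝟙 (p 0) + countBelow n (p ∘ suc)

countBelow-+ : ∀ a b p → countBelow (a + b) p ≡ countBelow a p + countBelow b (p ∘ (a +_))
countBelow-+ zero    b p = refl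
countBelow-+ (suc a) b p =
  trans (cong (𝟙 (p 0) +_) (countBelow-+ a b (p ∘ suc))) (sym (+-assoc (𝟙 (p 0)) _ _))

countBelow-const : ∀ n c → countBelow n (λ _ → c) ≡ (if c then n else 0)
countBelow-const zero    true  = refl
countBelow-const zero    false = refl
countBelow-const (suc n) true  = cong suc (countBelow-const n true)
countBelow-const (suc n) false = countBelow-const n false

count-val : ∀ {m} (p : ℕ → Bool) → count {m} (p ∘ val) ≡ countBelow (size m) p
count-val {zero}  p = sym (+-identityʳ _)
count-val {suc m} p =
  trans (cong₂ _+_ (count-val {m} p) (count-val {m} (p ∘ (size m +_))))
        (sym (countBelow-+ (size m) (size m) p))

size-positive : ∀ m → 1 ≤ size m
size-positive zero    = ≤-refl
size-positive (suc m) = ≤-trans (size-positive m) (m≤m+n (size m) (size m))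

val≡0⇒≡𝟎 : ∀ {m} (x : Point m) → val x ≡ 0 → x ≡ 𝟎
val≡0⇒≡𝟎 []          _  = refl
val≡0⇒≡𝟎 (false ∷ x) eq = cong (false ∷_) (val≡0⇒≡𝟎 x eq)
val≡0⇒≡𝟎 {suc m} (true ∷ x) eq =
  ⊥-elim (<⇒≢ (size-positive m) (sym (m+n≡0⇒m≡0 (size m) eq)))

-- An almost regular tournament

-- hd [] is a dummy value that makes the one-dimensional tournament fit the recursion.
hd : ∀ {m} → Point m → Bool
hd []      = false
hd (b ∷ x) = b

-- The first coordinate in which two points differ decides, together with the coordinate after it.
-- Among the points that first differ from x in a given coordinate other than the last, x beats
-- exactly half; an imbalance arises only from the single opponent that differs in the last
-- coordinate alone.
beats : ∀ {m} → Point m → Point m → Bool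
beats []          []          = false
beats (false ∷ x) (false ∷ y) = beats x y
beats (false ∷ x) (true  ∷ y) = hd x xor hd y
beats (true  ∷ x) (false ∷ y) = not (hd x xor hd y)
beats (true  ∷ x) (true  ∷ y) = beats x y

-- The last coordinate, which tells who wins that one unbalanced game.
strong : ∀ {m} → Point (suc m) → Bool
strong (b ∷ [])    = b
strong (b ∷ c ∷ x) = strong (c ∷ x)

beats-irrefl : ∀ {m} (x : Point m) → beats x x ≡ false
beats-irrefl []          = refl
beats-irrefl (false ∷ x) = beats-irrefl x
beats-irrefl (true  ∷ x) = beats-irrefl x

beats-antisym : ∀ {m} (x y : Point m) → x ≢ y → beats x y ≡ not (beats y x)
beats-antisym []          []          x≢y = ⊥-elim (x≢y refl)
beats-antisym (false ∷ x) (false ∷ y) x≢y = beats-antisym x y (x≢y ∘ cong (false ∷_))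
beats-antisym (false ∷ x) (true  ∷ y) x≢y = trans (xor-comm (hd x) (hd y)) (sym (not-involutive _))
beats-antisym (true  ∷ x) (false ∷ y) x≢y = cong not (xor-comm (hd x) (hd y))
beats-antisym (true  ∷ x) (true  ∷ y) x≢y = beats-antisym x y (x≢y ∘ cong (true ∷_))

wins losses : ∀ {m} → Point m → ℕ
wins   x = count (beats x)
losses x = count (λ y → beats y x)

private
  all+none : ∀ m → count {m} (λ _ → true) + count {m} (λ _ → false) ≡ size m
  all+none m = trans (cong₂ _+_ (count-true m) (count-false m)) (+-identityʳ _)

  none+all : ∀ m → count {m} (λ _ → false) + count {m} (λ _ → true) ≡ size m
  none+all m = cong₂ _+_ (count-false m) (count-true m)

  extend : ∀ {w h s} c → suc w ≡ h + s → c ≡ h → suc (w + c) ≡ h + h + s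
  extend {h = h} {s} c eq refl = trans (cong (_+ h) eq) (lemma h s)
    where
    lemma : ∀ h s → h + s + h ≡ h + h + s
    lemma = solve-∀

  extend′ : ∀ {h} w s c → w + s ≡ h → c ≡ h → w + c + s ≡ h + h
  extend′ {h} w s c eq refl = trans (lemma w h s) (cong (_+ h) eq)
    where
    lemma : ∀ w h s → w + h + s ≡ w + s + h
    lemma = solve-∀

-- Of the points with the other first coordinate, those with one of the two values of the second
-- coordinate are beaten. This adds `size m` wins, and the excess is inherited from the tail.
wins-strong : ∀ {m} (x : Point (suc m)) → suc (wins x) ≡ size m + 𝟙 (strong x)
wins-strong (true  ∷ []) = refl
wins-strong (false ∷ []) = refl
wins-strong {suc m} (false ∷ false ∷ x) = extend _ (wins-strong (false ∷ x)) (none+all m)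
wins-strong {suc m} (false ∷ true  ∷ x) = extend _ (wins-strong (true ∷ x)) (all+none m)
wins-strong {suc m} (true  ∷ false ∷ x) =
  trans (cong suc (+-comm _ (wins (false ∷ x)))) (extend _ (wins-strong (false ∷ x)) (all+none m))
wins-strong {suc m} (true  ∷ true  ∷ x) =
  trans (cong suc (+-comm _ (wins (true ∷ x)))) (extend _ (wins-strong (true ∷ x)) (none+all m))

losses-strong : ∀ {m} (x : Point (suc m)) → losses x + 𝟙 (strong x) ≡ size m
losses-strong (true  ∷ []) = refl
losses-strong (false ∷ []) = refl
losses-strong {suc m} (false ∷ false ∷ x) = extend′ (losses (false ∷ x)) _ _ (losses-strong (false ∷ x)) (all+none m)
losses-strong {suc m} (false ∷ true  ∷ x) = extend′ (losses (true ∷ x)) _ _ (losses-strong (true ∷ x)) (none+all m)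
losses-strong {suc m} (true  ∷ false ∷ x) =
  trans (cong (_+ 𝟙 (strong (false ∷ x))) (+-comm (count {suc m} (λ y → hd y xor false)) (losses (false ∷ x))))
        (extend′ (losses (false ∷ x)) _ _ (losses-strong (false ∷ x)) (none+all m))
losses-strong {suc m} (true  ∷ true  ∷ x) =
  trans (cong (_+ 𝟙 (strong (true ∷ x))) (+-comm (count {suc m} (λ y → hd y xor true)) (losses (true ∷ x))))
        (extend′ (losses (true ∷ x)) _ _ (losses-strong (true ∷ x)) (all+none m))

-- Linear maps A with A and I + A invertible

-- Invertibility is recorded in the form in which it is applied: substituting A x or x + A x for x
-- leaves counts unchanged. Injectivity of A serves to transport the tournament along A.
record Twist (m : ℕ) : Set where
  field
    A           : Point m → Point m
    A-⊕         : ∀ x y → A (x ⊕ y) ≡ A x ⊕ A y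
    A-injective : ∀ x y → A x ≡ A y → x ≡ y
    count-A     : ∀ f → count (f ∘ A) ≡ count f
    count-I+A   : ∀ f → count (λ x → f (x ⊕ A x)) ≡ count f

xor-cancelˡ : ∀ a b → a xor (a xor b) ≡ b
xor-cancelˡ true  b = not-involutive b
xor-cancelˡ false b = refl

-- On the one-point space I + A is zero and still bijective.
twist₀ : Twist 0
twist₀ = record
  { A = λ x → x ; A-⊕ = λ _ _ → refl ; A-injective = λ _ _ eq → eq
  ; count-A = λ _ → refl ; count-I+A = λ { f → refl } }

-- Multiplication by a root of X³ = X + 1 in F₈.
twist₃ : Twist 3
twist₃ = record
  { A = A
  ; A-⊕ = λ { (a ∷ b ∷ c ∷ []) (a′ ∷ b′ ∷ c′ ∷ []) →
               cong (λ e → (b xor b′) ∷ (c xor c′) ∷ e ∷ []) (xor-interchange a a′ b b′) }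
  ; A-injective = λ x y eq → trans (sym (A⁻¹-A x)) (trans (cong A⁻¹ eq) (A⁻¹-A y))
  -- The arguments are the values of f at A x for the eight x in lexicographic order; the
  -- permutation restores the order of summation of `count f`. The same is done for x + A x below.
  ; count-A = λ f → let v = value f in
      permute₁ (v false false false) (v false true false) (v true false true) (v true true true)
               (v false false true) (v false true true) (v true false false) (v true true false)
  ; count-I+A = λ f → let v = value f in
      permute₂ (v false false false) (v false true true) (v true true true) (v true false false)
               (v true false true) (v true true false) (v false true false) (v false false true) }
  where
  A A⁻¹ : Point 3 → Point 3
  A   (a ∷ b ∷ c ∷ []) = b ∷ c ∷ (a xor b) ∷ []
  A⁻¹ (a ∷ b ∷ c ∷ []) = (c xor a) ∷ a ∷ b ∷ []
  A⁻¹-A : ∀ x → A⁻¹ (A x) ≡ x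
  A⁻¹-A (a ∷ b ∷ c ∷ []) =
    cong (_∷ b ∷ c ∷ []) (trans (xor-comm (a xor b) b) (trans (cong (b xor_) (xor-comm a b)) (xor-cancelˡ b a)))
  value : (Point 3 → Bool) → Bool → Bool → Bool → ℕ
  value f a b c = 𝟙 (f (a ∷ b ∷ c ∷ []))
  permute₁ : ∀ a b c d e f g h →
    ((a + b) + (c + d)) + ((e + f) + (g + h)) ≡ ((a + e) + (b + f)) + ((g + c) + (h + d))
  permute₁ = solve-∀
  permute₂ : ∀ a b c d e f g h →
    ((a + b) + (c + d)) + ((e + f) + (g + h)) ≡ ((a + h) + (g + b)) + ((d + e) + (f + c))
  permute₂ = solve-∀

-- On the new coordinates (i, j) ↦ (j, i + j) is multiplication by a generator ω of the field F₄,
-- and 1 + ω = ω² is invertible as well. Both maps permute the three nonzero pairs cyclically,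
-- whence the reordering of quarters in `lemma₁` and `lemma₂`.
twist-step : ∀ {m} → Twist m → Twist (2 + m)
twist-step {m} W = record
  { A = A′
  ; A-⊕ = λ { (i ∷ j ∷ x) (i′ ∷ j′ ∷ x′) →
      cong₂ (λ e y → (j xor j′) ∷ e ∷ y) (xor-interchange i i′ j j′) (A-⊕ x x′) }
  ; A-injective = injective
  ; count-A = λ f → trans
      (cong₂ _+_ (cong₂ _+_ (count-A (λ x → f (false ∷ false ∷ x))) (count-A (λ x → f (true ∷ true ∷ x))))
                 (cong₂ _+_ (count-A (λ x → f (false ∷ true ∷ x))) (count-A (λ x → f (true ∷ false ∷ x)))))
      (lemma₁ (count (λ x → f (false ∷ false ∷ x))) _ _ _)
  ; count-I+A = λ f → trans
      (cong₂ _+_ (cong₂ _+_ (count-I+A (λ x → f (false ∷ false ∷ x))) (count-I+A (λ x → f (true ∷ false ∷ x))))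
                 (cong₂ _+_ (count-I+A (λ x → f (true ∷ true ∷ x))) (count-I+A (λ x → f (false ∷ true ∷ x)))))
      (lemma₂ (count (λ x → f (false ∷ false ∷ x))) _ _ _) }
  where
  open Twist W
  A′ : Point (2 + m) → Point (2 + m)
  A′ (i ∷ j ∷ x) = j ∷ (i xor j) ∷ A x
  injective : ∀ x y → A′ x ≡ A′ y → x ≡ y
  injective (i ∷ j ∷ x) (i′ ∷ j′ ∷ y) eq = cong₂ _∷_ (bits i j i′ j′ (cong (hd ∘ tl) eq) (cong hd eq))
    (cong₂ _∷_ (cong hd eq) (A-injective x y (∷-injectiveʳ (∷-injectiveʳ eq))))
    where
    tl : ∀ {n} → Point (suc n) → Point n
    tl (_ ∷ z) = z
    bits : ∀ i j i′ j′ → i xor j ≡ i′ xor j′ → j ≡ j′ → i ≡ i′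
    bits i j i′ .j eq refl = trans (sym (xor-cancelˡ j i))
      (trans (cong (j xor_) (trans (xor-comm j i) (trans eq (xor-comm i′ j)))) (xor-cancelˡ j i′))
  lemma₁ : ∀ a b c d → (a + b) + (c + d) ≡ (a + c) + (d + b)
  lemma₁ = solve-∀
  lemma₂ : ∀ a b c d → (a + b) + (c + d) ≡ (a + d) + (b + c)
  lemma₂ = solve-∀

-- Balanced assignments of the lines of PG(m-1,2) to their points

exactlyOne : Bool → Bool → Bool → Bool
exactlyOne true  y z = not (y ∨ z)
exactlyOne false y z = y xor z

-- P a b states that the line {a, b, a ⊕ b} is assigned to a; a line assigned
-- to a is counted twice by count (P a).
record Assignment (m k ε : ℕ) : Set where
  field
    P       : Point m → Point m → Bool
    P-shift : ∀ a b → P a (a ⊕ b) ≡ P a b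
    P-𝟎     : ∀ a → a ≢ 𝟎 → P a 𝟎 ≡ false
    P-exact : ∀ a b → a ≢ 𝟎 → b ≢ 𝟎 → a ≢ b →
              exactlyOne (P a b) (P b a) (P (a ⊕ b) a) ≡ true
    P-lower : ∀ a → a ≢ 𝟎 → k + k ≤ count (P a)
    P-upper : ∀ a → a ≢ 𝟎 → count (P a) ≤ (k + ε) + (k + ε)
    P-min   : ∃[ a ] (a ≢ 𝟎 × count (P a) ≡ k + k)
    P-max   : ∃[ a ] (a ≢ 𝟎 × count (P a) ≡ (k + ε) + (k + ε))

-- The recursion step: adding two dimensions

data Label : Set where
  row col symbol : Label

isRow isCol isSym : Label → Bool
isRow row = true
isRow _   = false
isCol col = true
isCol _   = false
isSym symbol = true
isSym _    = false

prepend : ℕ → Label → (ℕ → Label) → ℕ → Label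
prepend zero    l f n       = f n
prepend (suc k) l f zero    = l
prepend (suc k) l f (suc n) = prepend k l f n

countBelow-prepend : ∀ k r (p : Label → Bool) l f →
  countBelow (k + r) (p ∘ prepend k l f) ≡ (if p l then k else 0) + countBelow r (p ∘ f)
countBelow-prepend zero    r p l f with p l
... | true  = refl
... | false = refl
countBelow-prepend (suc k) r p l f with p l | countBelow-prepend k r p l f
... | true  | ih = cong suc ih
... | false | ih = ih

-- With 2h - 1 points and (2h - 1)(2h - 2)/6 lines the average load is (h - 1)/3, so `size-eq` says
-- that this average is k + ε/3.
module Step {m k ε : ℕ} (W : Twist (suc m)) (S : Assignment (suc m) k ε)
            (size-eq : size m ≡ suc (k + k + k + ε)) where
  open Twist W
  open Assignment S

  private
    V = Point (suc m)
    h = size m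

  labels : ℕ → Label
  labels = prepend k row (prepend k col (λ _ → symbol))

  -- A cell of value 0 has y = A z. If y is strong, its row has won h edges, while its column, which
  -- counts losses, has only h - 1 and receives the cell. Otherwise row and column change roles.
  label : ℕ → Bool → Label
  label zero    true  = col
  label zero    false = row
  label (suc n) _     = labels n

  -- The line through (0,1,y) and (1,1,z) meets level (1,0) in y ⊕ z.  Since
  -- y ⊕ A z is an orthogonal mate of the Latin square y ⊕ z, each of its values
  -- occurs once in every row, column and symbol class.  The cells of value 0
  -- compensate for the tournament being only almost regular.
  cell : V → V → Label
  cell y z = label (val (y ⊕ A z)) (strong y)

  private
    -- The 2h mate values split into the value 0, then k for the rows, k for the columns and h + k +
    -- ε for the symbols.
    h+h : h + h ≡ suc (k + (k + (h + k + ε)))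
    h+h = trans (cong (_+ h) size-eq) (lemma k ε h)
      where
      lemma : ∀ k ε h → suc (k + k + k + ε) + h ≡ suc (k + (k + (h + k + ε)))
      lemma = solve-∀

  count-label : ∀ (p : Label → Bool) b → count {suc m} (λ u → p (label (val u) b)) ≡
    𝟙 (p (label 0 b)) + ((if p row then k else 0) + ((if p col then k else 0)
                                        + (if p symbol then h + k + ε else 0)))
  count-label p b =
    trans (count-val {suc m} (λ v → p (label v b)))
    (trans (cong (λ n → countBelow n (λ v → p (label v b))) h+h)
    (cong (𝟙 (p (label 0 b)) +_)
      (trans (countBelow-prepend k _ p row _)
        (cong ((if p row then k else 0) +_)
          (trans (countBelow-prepend k _ p col _)
            (cong ((if p col then k else 0) +_) (countBelow-const _ (p symbol))))))))

  count-row : ∀ (p : Label → Bool) y → count (λ z → p (cell y z)) ≡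
              count {suc m} (λ u → p (label (val u) (strong y)))
  count-row p y = trans (count-A (λ z → p (label (val (y ⊕ z)) (strong y))))
                        (count-translate y (λ u → p (label (val u) (strong y))))

  -- Along a column `strong y` varies with y, but it is consulted only at value 0, that is, at y = A
  -- z.
  count-col : ∀ (p : Label → Bool) z → count (λ y → p (cell y z)) ≡
              count {suc m} (λ u → p (label (val u) (strong (A z))))
  count-col p z =
    trans (sym (count-translate (A z) (λ y → p (cell y z)))) (count-cong λ u → cong p (lemma u))
    where
    relabel : ∀ v u → val u ≡ v → label v (strong (A z ⊕ u)) ≡ label v (strong (A z))
    relabel (suc n) u eq = refl
    relabel zero u eq =
      cong (λ w → label 0 (strong w)) (trans (cong (A z ⊕_) (val≡0⇒≡𝟎 u eq)) (⊕-identityʳ (A z)))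
    lemma : ∀ u → cell (A z ⊕ u) z ≡ label (val u) (strong (A z))
    lemma u = trans (cong (λ w → label (val w) (strong (A z ⊕ u)))
                          (⊕-cancel-outer (A z) u))
                    (relabel (val u) u refl)

  -- In the class of the symbol x one has z = x + y, so the mate value is A x + (y + A y); here the
  -- invertibility of I + A enters. The cell of value 0 never goes to a symbol, so `strong` can be
  -- replaced by a constant.
  count-sym : ∀ x → count (λ y → isSym (cell y (x ⊕ y))) ≡ h + k + ε
  count-sym x =
    trans (count-cong λ y → trans (drop-strong (val (y ⊕ A (x ⊕ y))) (strong y))
                                  (cong (λ u → isSym (label (val u) false)) (rearrange y)))
    (trans (count-I+A (λ u → isSym (label (val (A x ⊕ u)) false)))
    (trans (count-translate (A x) (λ u → isSym (label (val u) false)))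
           (count-label isSym false)))
    where
    drop-strong : ∀ v b → isSym (label v b) ≡ isSym (label v false)
    drop-strong zero    true  = refl
    drop-strong zero    false = refl
    drop-strong (suc v) b     = refl
    rearrange : ∀ y → y ⊕ A (x ⊕ y) ≡ A x ⊕ (y ⊕ A y)
    rearrange y = trans (cong (y ⊕_) (A-⊕ x y))
      (⊕-solve (y ∷ A x ∷ A y ∷ []) (𝕒 :+ (𝕓 :+ 𝕔)) (𝕓 :+ (𝕒 :+ 𝕔)) refl)

  -- Levels: (0,0) the old space, (0,1) rows, (1,0) symbols, (1,1) columns.
  P′ : Point (3 + m) → Point (3 + m) → Bool
  P′ (false ∷ false ∷ a) (false ∷ false ∷ b)  = P a b
  P′ (false ∷ false ∷ a) (false ∷ true  ∷ y)  = false
  P′ (false ∷ false ∷ a) (true  ∷ false ∷ x)  = true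
  P′ (false ∷ false ∷ a) (true  ∷ true  ∷ z)  = false
  P′ (false ∷ true  ∷ y) (false ∷ false ∷ a)  = beats y (y ⊕ a)
  P′ (false ∷ true  ∷ y) (false ∷ true  ∷ y′) = beats y y′
  P′ (false ∷ true  ∷ y) (true  ∷ false ∷ x)  = isRow (cell y (x ⊕ y))
  P′ (false ∷ true  ∷ y) (true  ∷ true  ∷ z)  = isRow (cell y z)
  P′ (true  ∷ false ∷ x) (false ∷ false ∷ a)  = false
  P′ (true  ∷ false ∷ x) (false ∷ true  ∷ y)  = isSym (cell y (x ⊕ y))
  P′ (true  ∷ false ∷ x) (true  ∷ false ∷ x′) = false
  P′ (true  ∷ false ∷ x) (true  ∷ true  ∷ z)  = isSym (cell (x ⊕ z) z)
  P′ (true  ∷ true  ∷ z) (false ∷ false ∷ a)  = beats (A (z ⊕ a)) (A z)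
  P′ (true  ∷ true  ∷ z) (false ∷ true  ∷ y)  = isCol (cell y z)
  P′ (true  ∷ true  ∷ z) (true  ∷ false ∷ x)  = isCol (cell (x ⊕ z) z)
  P′ (true  ∷ true  ∷ z) (true  ∷ true  ∷ z′) = beats (A z′) (A z)

  P′-shift : ∀ p q → P′ p (p ⊕ q) ≡ P′ p q
  P′-shift (false ∷ false ∷ a) (false ∷ false ∷ b)  = P-shift a b
  P′-shift (false ∷ false ∷ a) (false ∷ true  ∷ y)  = refl
  P′-shift (false ∷ false ∷ a) (true  ∷ false ∷ x)  = refl
  P′-shift (false ∷ false ∷ a) (true  ∷ true  ∷ z)  = refl
  P′-shift (false ∷ true  ∷ y) (false ∷ false ∷ a)  = refl
  P′-shift (false ∷ true  ∷ y) (false ∷ true  ∷ y′) = cong (beats y) (⊕-cancelˡ y y′)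
  P′-shift (false ∷ true  ∷ y) (true  ∷ false ∷ x)  = cong (isRow ∘ cell y) (⊕-comm y x)
  P′-shift (false ∷ true  ∷ y) (true  ∷ true  ∷ z)  = cong (isRow ∘ cell y) (⊕-cancel-outer y z)
  P′-shift (true  ∷ false ∷ x) (false ∷ false ∷ a)  = refl
  P′-shift (true  ∷ false ∷ x) (false ∷ true  ∷ y)  = cong (λ w → isSym (cell w (x ⊕ y))) (⊕-cancelˡ x y)
  P′-shift (true  ∷ false ∷ x) (true  ∷ false ∷ x′) = refl
  P′-shift (true  ∷ false ∷ x) (true  ∷ true  ∷ z)  = cong (λ w → isSym (cell (x ⊕ z) w)) (⊕-cancelˡ x z)
  P′-shift (true  ∷ true  ∷ z) (false ∷ false ∷ a)  = refl
  P′-shift (true  ∷ true  ∷ z) (false ∷ true  ∷ y)  = cong (λ w → isCol (cell w z)) (⊕-cancel-outer z y)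
  P′-shift (true  ∷ true  ∷ z) (true  ∷ false ∷ x)  = cong (λ w → isCol (cell w z)) (⊕-comm z x)
  P′-shift (true  ∷ true  ∷ z) (true  ∷ true  ∷ z′) = cong (λ w → beats (A w) (A z)) (⊕-cancelˡ z z′)

  P′-𝟎 : ∀ p → p ≢ 𝟎 → P′ p 𝟎 ≡ false
  P′-𝟎 (false ∷ false ∷ a) p≢𝟎 = P-𝟎 a (p≢𝟎 ∘ cong (λ w → false ∷ false ∷ w))
  P′-𝟎 (false ∷ true  ∷ y) _   = trans (cong (beats y) (⊕-identityʳ y)) (beats-irrefl y)
  P′-𝟎 (true  ∷ false ∷ x) _   = refl
  P′-𝟎 (true  ∷ true  ∷ z) _   =
    trans (cong (λ w → beats (A w) (A z)) (⊕-identityʳ z)) (beats-irrefl (A z))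

  private
    not-xor : ∀ {b c} → b ≡ not c → b xor c ≡ true
    not-xor {c = true}  refl = refl
    not-xor {c = false} refl = refl

    -- On a line that is an edge of the tournament, the point in V never receives the line. The
    -- three variants have it in first, second and third place.
    one-beats₁ : ∀ {n} (x y : Point n) → x ≢ y →
                 exactlyOne false (beats x y) (beats y x) ≡ true
    one-beats₁ x y x≢y = not-xor (beats-antisym x y x≢y)

    one-beats₂ : ∀ {n} (x y : Point n) → x ≢ y →
                 exactlyOne (beats x y) false (beats y x) ≡ true
    one-beats₂ x y x≢y with beats x y | beats y x | beats-antisym x y x≢y
    ... | true  | false | _ = refl
    ... | false | true  | _ = refl

    one-beats₃ : ∀ {n} (x y : Point n) → x ≢ y →
                 exactlyOne (beats x y) (beats y x) false ≡ true
    one-beats₃ x y x≢y with beats x y | beats y x | beats-antisym x y x≢y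
    ... | true  | false | _ = refl
    ... | false | true  | _ = refl

    ≢-shift : ∀ {n} {a y : Point n} → a ≢ 𝟎 → y ≢ y ⊕ a
    ≢-shift {a = a} {y} a≢𝟎 eq =
      a≢𝟎 (trans (sym (⊕-cancelˡ y a)) (trans (cong (y ⊕_) (sym eq)) (⊕-self y)))

    old≢𝟎 : ∀ {a : V} → _≢_ {A = Point (3 + m)} (false ∷ false ∷ a) 𝟎 → a ≢ 𝟎
    old≢𝟎 p≢𝟎 = p≢𝟎 ∘ cong (λ w → false ∷ false ∷ w)

    A≢ : ∀ {x y} → x ≢ y → A x ≢ A y
    A≢ x≢y = x≢y ∘ A-injective _ _

    -- The letters give the order in which row, symbol and column of a cell occur as p, q, p + q.
    label-RSC : ∀ l → exactlyOne (isRow l) (isSym l) (isCol l) ≡ true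
    label-RSC row  = refl
    label-RSC col  = refl
    label-RSC symbol = refl

    label-RCS : ∀ l → exactlyOne (isRow l) (isCol l) (isSym l) ≡ true
    label-RCS row  = refl
    label-RCS col  = refl
    label-RCS symbol = refl

    label-SRC : ∀ l → exactlyOne (isSym l) (isRow l) (isCol l) ≡ true
    label-SRC row  = refl
    label-SRC col  = refl
    label-SRC symbol = refl

    label-SCR : ∀ l → exactlyOne (isSym l) (isCol l) (isRow l) ≡ true
    label-SCR row  = refl
    label-SCR col  = refl
    label-SCR symbol = refl

    label-CRS : ∀ l → exactlyOne (isCol l) (isRow l) (isSym l) ≡ true
    label-CRS row  = refl
    label-CRS col  = refl
    label-CRS symbol = refl

    label-CSR : ∀ l → exactlyOne (isCol l) (isSym l) (isRow l) ≡ true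
    label-CSR row  = refl
    label-CSR col  = refl
    label-CSR symbol = refl

  -- A line lies in V, or has one point in V and two on one new level, or meets each new level once.
  -- The rewrites make its third value refer to the same edge or cell as the other two.
  P′-exact : ∀ p q → p ≢ 𝟎 → q ≢ 𝟎 → p ≢ q → exactlyOne (P′ p q) (P′ q p) (P′ (p ⊕ q) p) ≡ true
  P′-exact (false ∷ false ∷ a) (false ∷ false ∷ b) p≢𝟎 q≢𝟎 p≢q =
    P-exact a b (old≢𝟎 p≢𝟎) (old≢𝟎 q≢𝟎) (p≢q ∘ cong (λ w → false ∷ false ∷ w))
  P′-exact (false ∷ false ∷ a) (false ∷ true ∷ y) p≢𝟎 _ _
    rewrite ⊕-comm a y | ⊕-cancelʳ y a = one-beats₁ y (y ⊕ a) (≢-shift (old≢𝟎 p≢𝟎))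
  P′-exact (false ∷ false ∷ a) (true ∷ false ∷ x) _ _ _ = refl
  P′-exact (false ∷ false ∷ a) (true ∷ true ∷ z) p≢𝟎 _ _
    rewrite ⊕-comm a z | ⊕-cancelʳ z a =
    one-beats₁ (A (z ⊕ a)) (A z) (A≢ (≢-shift (old≢𝟎 p≢𝟎) ∘ sym))
  P′-exact (false ∷ true ∷ y) (false ∷ false ∷ a) _ q≢𝟎 _ =
    one-beats₂ y (y ⊕ a) (≢-shift (old≢𝟎 q≢𝟎))
  P′-exact (false ∷ true ∷ y) (false ∷ true ∷ y′) _ _ p≢q =
    one-beats₃ y y′ (p≢q ∘ cong (λ w → false ∷ true ∷ w))
  P′-exact (false ∷ true ∷ y) (true ∷ false ∷ x) _ _ _
    rewrite ⊕-comm y x = label-RSC (cell y (x ⊕ y))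
  P′-exact (false ∷ true ∷ y) (true ∷ true ∷ z) _ _ _
    rewrite ⊕-cancel-outer y z = label-RCS (cell y z)
  P′-exact (true ∷ false ∷ x) (false ∷ false ∷ a) _ _ _ = refl
  P′-exact (true ∷ false ∷ x) (false ∷ true ∷ y) _ _ _
    rewrite ⊕-cancelˡ x y = label-SRC (cell y (x ⊕ y))
  P′-exact (true ∷ false ∷ x) (true ∷ false ∷ x′) _ _ _ = refl
  P′-exact (true ∷ false ∷ x) (true ∷ true ∷ z) _ _ _
    rewrite ⊕-cancelˡ x z = label-SCR (cell (x ⊕ z) z)
  P′-exact (true ∷ true ∷ z) (false ∷ false ∷ a) _ q≢𝟎 _ =
    one-beats₂ (A (z ⊕ a)) (A z) (A≢ (≢-shift (old≢𝟎 q≢𝟎) ∘ sym))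
  P′-exact (true ∷ true ∷ z) (false ∷ true ∷ y) _ _ _
    rewrite ⊕-cancel-outer z y = label-CRS (cell y z)
  P′-exact (true ∷ true ∷ z) (true ∷ false ∷ x) _ _ _
    rewrite ⊕-comm z x = label-CSR (cell (x ⊕ z) z)
  P′-exact (true ∷ true ∷ z) (true ∷ true ∷ z′) _ _ p≢q =
    one-beats₃ (A z′) (A z) (A≢ (p≢q ∘ cong (λ w → true ∷ true ∷ w) ∘ sym))

  -- The new lines received by a are the h lines through a and level (1,0), each counted twice.
  count-old : ∀ a → count (P′ (false ∷ false ∷ a)) ≡ count (P a) + (h + h)
  count-old a =
    trans (cong₂ _+_ (cong (count (P a) +_) (count-false (suc m)))
                     (cong₂ _+_ (count-true (suc m)) (count-false (suc m))))
          (cong₂ _+_ (+-identityʳ (count (P a))) (+-identityʳ (h + h)))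

  private
    -- Two of the four levels of q show the same edges and the other two the same cells, since each
    -- line is counted through both of its further points.
    double : ∀ {a b c d w l n} → a ≡ w → b ≡ w → c ≡ l → d ≡ l → w + l ≡ n →
             (a + b) + (c + d) ≡ n + n
    double {w = w} {l} refl refl refl refl refl = lemma w l
      where
      lemma : ∀ w l → (w + w) + (l + l) ≡ (w + l) + (w + l)
      lemma = solve-∀

    row-total : ∀ {w} b → suc w ≡ h + 𝟙 b → w + (𝟙 (not b) + (k + 0)) ≡ h + k
    row-total {w} true  eq = cong₂ _+_ (suc-injective (trans eq (+-comm h 1))) (+-identityʳ k)
    row-total {w} false eq =
      trans (+-suc w (k + 0)) (cong₂ _+_ (trans eq (+-identityʳ h)) (+-identityʳ k))

    col-total : ∀ {w} b → w + 𝟙 b ≡ h → w + (𝟙 b + k) ≡ h + k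
    col-total {w} b eq = trans (sym (+-assoc w (𝟙 b) k)) (cong (_+ k) eq)

    isRow-label₀ : ∀ b → isRow (label 0 b) ≡ not b
    isRow-label₀ true  = refl
    isRow-label₀ false = refl

    isCol-label₀ : ∀ b → isCol (label 0 b) ≡ b
    isCol-label₀ true  = refl
    isCol-label₀ false = refl

  count-new-row : ∀ y → count (P′ (false ∷ true ∷ y)) ≡ (h + k) + (h + k)
  count-new-row y =
    double (count-translate y (beats y)) refl
           (trans (count-cong λ x → cong (isRow ∘ cell y) (⊕-comm x y))
                  (trans (count-translate y (isRow ∘ cell y)) rows))
           rows
           (row-total (strong y) (wins-strong y))
    where
    rows : count (isRow ∘ cell y) ≡ 𝟙 (not (strong y)) + (k + 0)
    rows = trans (count-row isRow y)
                 (trans (count-label isRow (strong y))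
                        (cong (λ b → 𝟙 b + (k + 0)) (isRow-label₀ (strong y))))

  -- On level (1,1) an edge goes to its loser in the tournament transported along A. Hence the
  -- columns short of one edge are those with A z strong, which are the ones given their cell of
  -- value 0.
  count-new-col : ∀ z → count (P′ (true ∷ true ∷ z)) ≡ (h + k) + (h + k)
  count-new-col z =
    trans (lemma (count (λ a → beats (A (z ⊕ a)) (A z))) _ _ _)
    (double (trans (count-translate z (λ a → beats (A a) (A z))) lost) lost
            cols
            (trans (count-cong λ x → cong (λ w → isCol (cell w z)) (⊕-comm x z))
                   (trans (count-translate z (λ y → isCol (cell y z))) cols))
            (col-total (strong (A z)) (losses-strong (A z))))
    where
    lemma : ∀ a b c d → (a + b) + (c + d) ≡ (a + d) + (b + c)
    lemma = solve-∀
    lost : count (λ a → beats (A a) (A z)) ≡ losses (A z)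
    lost = count-A (λ w → beats w (A z))
    cols : count (λ y → isCol (cell y z)) ≡ 𝟙 (strong (A z)) + k
    cols = trans (count-col isCol z)
           (trans (count-label isCol (strong (A z)))
                  (cong₂ (λ b c → 𝟙 b + c) (isCol-label₀ (strong (A z))) (+-identityʳ k)))

  count-new-sym : ∀ x → count (P′ (true ∷ false ∷ x)) ≡ (h + k + ε) + (h + k + ε)
  count-new-sym x =
    trans (lemma (count {suc m} (λ _ → false)) _ _ _)
    (double (count-false (suc m)) (count-false (suc m)) (count-sym x)
      (trans (trans (count-cong λ z → cong (λ w → isSym (cell (x ⊕ z) w)) (sym (⊕-cancelˡ x z)))
                    (count-translate x (λ y → isSym (cell y (x ⊕ y)))))
             (count-sym x))
      refl)
    where
    lemma : ∀ a b c d → (a + b) + (c + d) ≡ (a + c) + (b + d)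
    lemma = solve-∀

  private
    low≤high : (h + k) + (h + k) ≤ (h + k + ε) + (h + k + ε)
    low≤high = +-mono-≤ (m≤m+n (h + k) ε) (m≤m+n (h + k) ε)

  P′-lower : ∀ p → p ≢ 𝟎 → (h + k) + (h + k) ≤ count (P′ p)
  P′-lower (false ∷ false ∷ a) p≢𝟎 = begin
    (h + k) + (h + k)       ≡⟨ lemma h k ⟩
    (k + k) + (h + h)       ≤⟨ +-monoˡ-≤ (h + h) (P-lower a (old≢𝟎 p≢𝟎)) ⟩
    count (P a) + (h + h)   ≡⟨ count-old a ⟨
    count (P′ (false ∷ false ∷ a)) ∎
    where
    open ≤-Reasoning
    lemma : ∀ h k → (h + k) + (h + k) ≡ (k + k) + (h + h)
    lemma = solve-∀
  P′-lower (false ∷ true  ∷ y) _ = ≤-reflexive (sym (count-new-row y))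
  P′-lower (true  ∷ false ∷ x) _ = ≤-trans low≤high (≤-reflexive (sym (count-new-sym x)))
  P′-lower (true  ∷ true  ∷ z) _ = ≤-reflexive (sym (count-new-col z))

  P′-upper : ∀ p → p ≢ 𝟎 → count (P′ p) ≤ (h + k + ε) + (h + k + ε)
  P′-upper (false ∷ false ∷ a) p≢𝟎 = begin
    count (P′ (false ∷ false ∷ a))    ≡⟨ count-old a ⟩
    count (P a) + (h + h)             ≤⟨ +-monoˡ-≤ (h + h) (P-upper a (old≢𝟎 p≢𝟎)) ⟩
    ((k + ε) + (k + ε)) + (h + h)     ≡⟨ lemma h k ε ⟩
    (h + k + ε) + (h + k + ε)         ∎
    where
    open ≤-Reasoning
    lemma : ∀ h k ε → ((k + ε) + (k + ε)) + (h + h) ≡ (h + k + ε) + (h + k + ε)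
    lemma = solve-∀
  P′-upper (false ∷ true  ∷ y) _ = ≤-trans (≤-reflexive (count-new-row y)) low≤high
  P′-upper (true  ∷ false ∷ x) _ = ≤-reflexive (count-new-sym x)
  P′-upper (true  ∷ true  ∷ z) _ = ≤-trans (≤-reflexive (count-new-col z)) low≤high

  step : Assignment (3 + m) (h + k) ε
  step = record
    { P = P′ ; P-shift = P′-shift ; P-𝟎 = P′-𝟎 ; P-exact = P′-exact
    ; P-lower = P′-lower ; P-upper = P′-upper
    -- All rows have load h + k and all symbols h + k + ε, so any points on these levels attain the
    -- two bounds.
    ; P-min = (false ∷ true ∷ 𝟎) , (λ ()) , count-new-row 𝟎
    ; P-max = (true ∷ false ∷ 𝟎) , (λ ()) , count-new-sym 𝟎 }

  step-size : size (2 + m) ≡ suc ((h + k) + (h + k) + (h + k) + ε)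
  step-size = trans (cong (λ n → (n + h) + (h + h)) size-eq) (lemma h k ε)
    where
    lemma : ∀ h k ε → (suc (k + k + k + ε) + h) + (h + h) ≡ suc ((h + k) + (h + k) + (h + k) + ε)
    lemma = solve-∀

-- Base cases in dimensions 2 and 3, by exhaustive check

all? : ∀ {m} {Q : Point m → Set} → Decidable Q → Dec (∀ x → Q x)
all? {zero}  Q? = map′ (λ { q [] → q }) (λ q → q []) (Q? [])
all? {suc m} Q? = map′ (λ { (q , r) (false ∷ x) → q x ; (q , r) (true ∷ x) → r x })
                       (λ q → (λ x → q (false ∷ x)) , (λ x → q (true ∷ x)))
                       (all? (λ x → Q? (false ∷ x)) ×-dec all? (λ x → Q? (true ∷ x)))

module SmallAssignment {m : ℕ} (P : Point m → Point m → Bool) where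

  nonzero? : Decidable (λ (a : Point m) → a ≢ 𝟎)
  nonzero? a = ¬? (a ≟ₚ 𝟎)

  shift? : Dec (∀ a b → P a (a ⊕ b) ≡ P a b)
  shift? = all? λ a → all? λ b → P a (a ⊕ b) Bool.≟ P a b

  𝟎? : Dec (∀ a → a ≢ 𝟎 → P a 𝟎 ≡ false)
  𝟎? = all? λ a → nonzero? a →-dec (P a 𝟎 Bool.≟ false)

  exact? : Dec (∀ a b → a ≢ 𝟎 → b ≢ 𝟎 → a ≢ b → exactlyOne (P a b) (P b a) (P (a ⊕ b) a) ≡ true)
  exact? = all? λ a → all? λ b → nonzero? a →-dec (nonzero? b →-dec (¬? (a ≟ₚ b) →-dec
             (exactlyOne (P a b) (P b a) (P (a ⊕ b) a) Bool.≟ true)))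

  lower? : ∀ n → Dec (∀ a → a ≢ 𝟎 → n ≤ count (P a))
  lower? n = all? λ a → nonzero? a →-dec (n ≤? count (P a))

  upper? : ∀ n → Dec (∀ a → a ≢ 𝟎 → count (P a) ≤ n)
  upper? n = all? λ a → nonzero? a →-dec (count (P a) ≤? n)

-- There is a single line, here assigned to (1, 0); the other two points on it are those with second
-- coordinate 1.
assignment₂ : Assignment 2 0 1
assignment₂ = record
  { P = P
  ; P-shift = from-yes shift? ; P-𝟎 = from-yes 𝟎? ; P-exact = from-yes exact?
  ; P-lower = from-yes (lower? 0) ; P-upper = from-yes (upper? 2)
  ; P-min = (false ∷ true ∷ []) , (λ ()) , refl
  ; P-max = (true ∷ false ∷ []) , (λ ()) , refl }
  where
  P : Point 2 → Point 2 → Bool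
  P (true ∷ false ∷ []) (_ ∷ b ∷ []) = b
  P _                   _            = false
  open SmallAssignment P

-- The lines of the Fano plane are {a, αa, α³a = a ⊕ αa} for the Singer cycle
-- α = A, and such a line is assigned to a.
assignment₃ : Assignment 3 1 0
assignment₃ = record
  { P = P
  ; P-shift = from-yes shift? ; P-𝟎 = from-yes 𝟎? ; P-exact = from-yes exact?
  ; P-lower = from-yes (lower? 2) ; P-upper = from-yes (upper? 2)
  ; P-min = (true ∷ 𝟎) , (λ ()) , refl
  ; P-max = (true ∷ 𝟎) , (λ ()) , refl }
  where
  open Twist twist₃ using (A)
  P : Point 3 → Point 3 → Bool
  P a b = does ((b ≟ₚ A a) ⊎-dec (b ≟ₚ (a ⊕ A a)))
  open SmallAssignment P

-- Balanced assignments in all dimensions from 2 on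

record Balanced (m ε : ℕ) : Set where
  field
    k          : ℕ
    twist      : Twist (suc m)
    assignment : Assignment (suc m) k ε
    size-eq    : size m ≡ suc (k + k + k + ε)

balanced-step : ∀ {m ε} → Balanced m ε → Balanced (2 + m) ε
balanced-step B = record
  { twist = twist-step twist ; assignment = step ; size-eq = step-size }
  where
  open Balanced B
  open Step twist assignment size-eq

-- The dimension is 2 + m, because `Balanced` is indexed by the dimension minus one; a step adds two
-- dimensions and keeps ε.
balanced-even : ∀ m → m % 2 ≡ 0 → Balanced (1 + m) 1
balanced-even zero          _  = record
  { k = 0 ; twist = twist-step twist₀ ; assignment = assignment₂ ; size-eq = refl }
balanced-even (suc (suc m)) eq = balanced-step (balanced-even m eq)

balanced-odd : ∀ m → m % 2 ≡ 1 → Balanced (1 + m) 0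
balanced-odd (suc zero)    _  = record
  { k = 1 ; twist = twist₃ ; assignment = assignment₃ ; size-eq = refl }
balanced-odd (suc (suc m)) eq = balanced-step (balanced-odd m eq)

-- Enumerations

allPoints : ∀ m → List (Point m)
allPoints zero    = [] ∷ []
allPoints (suc m) = map (false ∷_) (allPoints m) ++ map (true ∷_) (allPoints m)

∈-allPoints : ∀ {m} (x : Point m) → x ∈ allPoints m
∈-allPoints []          = here refl
∈-allPoints (false ∷ x) = ∈-++⁺ˡ (∈-map⁺ (false ∷_) (∈-allPoints x))
∈-allPoints {suc m} (true ∷ x) =
  ∈-++⁺ʳ (map (false ∷_) (allPoints m)) (∈-map⁺ (true ∷_) (∈-allPoints x))

allPoints-unique : ∀ m → Unique (allPoints m)
allPoints-unique zero    = [] ∷ []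
allPoints-unique (suc m) = Unique.++⁺ (Unique.map⁺ ∷-injectiveʳ (allPoints-unique m))
                                      (Unique.map⁺ ∷-injectiveʳ (allPoints-unique m)) disjoint
  where
  disjoint : ∀ {v} → v ∈ map (false ∷_) (allPoints m) × v ∈ map (true ∷_) (allPoints m) → ⊥
  disjoint (v∈₀ , v∈₁) with ∈-map⁻ (false ∷_) v∈₀ | ∈-map⁻ (true ∷_) v∈₁
  ... | _ , _ , refl | _ , _ , ()

length-filter-map : ∀ {A B : Set} (g : A → B) (f : B → Bool) xs →
  length (filter (λ y → f y Bool.≟ true) (map g xs)) ≡ length (filter (λ x → f (g x) Bool.≟ true) xs)
length-filter-map g f []       = refl
length-filter-map g f (x ∷ xs) with f (g x)
... | true  = cong suc (length-filter-map g f xs)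
... | false = length-filter-map g f xs

length-filter-allPoints : ∀ {m} (f : Point m → Bool) →
                          length (filter (λ x → f x Bool.≟ true) (allPoints m)) ≡ count f
length-filter-allPoints {zero} f with f []
... | true  = refl
... | false = refl
length-filter-allPoints {suc m} f =
  trans (cong length (filter-++ (λ x → f x Bool.≟ true) (map (false ∷_) (allPoints m)) _))
  (trans (length-++ (filter _ (map (false ∷_) (allPoints m))))
  (cong₂ _+_ (trans (length-filter-map (false ∷_) f (allPoints m)) (length-filter-allPoints (f ∘ (false ∷_))))
             (trans (length-filter-map (true ∷_) f (allPoints m)) (length-filter-allPoints (f ∘ (true ∷_))))))

private
  toBlock : ∀ {m} → (Point m × Point m) × (Point m × Point m) → NBlock m
  toBlock ((x , y) , (z , w)) = ⟨ x , y ∣ z , w ⟩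

  toBlock-injective : ∀ {m} {p q : (Point m × Point m) × (Point m × Point m)} →
                      toBlock p ≡ toBlock q → p ≡ q
  toBlock-injective refl = refl

allBlocks : ∀ m → List (NBlock m)
allBlocks m = map toBlock (cartesianProduct pairs pairs)
  where pairs = cartesianProduct (allPoints m) (allPoints m)

∈-allBlocks : ∀ {m} (B : NBlock m) → B ∈ allBlocks m
∈-allBlocks ⟨ x , y ∣ z , w ⟩ = ∈-map⁺ toBlock
  (∈-cartesianProduct⁺ (∈-cartesianProduct⁺ (∈-allPoints x) (∈-allPoints y))
                       (∈-cartesianProduct⁺ (∈-allPoints z) (∈-allPoints w)))

allBlocks-unique : ∀ m → Unique (allBlocks m)
allBlocks-unique m = Unique.map⁺ toBlock-injective (Unique.cartesianProduct⁺ pairs pairs)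
  where pairs = Unique.cartesianProduct⁺ (allPoints-unique m) (allPoints-unique m)

length-≡ : ∀ {A : Set} {xs ys : List A} → Unique xs → Unique ys →
           (∀ {z} → z ∈ xs ⇔ z ∈ ys) → length xs ≡ length ys
length-≡ xs! ys! xs~ys = ↭-length (∼bag⇒↭ (unique∧set⇒bag xs! ys! xs~ys))

-- Lexicographic order

precedes : ∀ {m} → Point m → Point m → Bool
precedes []          []          = false
precedes (false ∷ x) (false ∷ y) = precedes x y
precedes (false ∷ x) (true  ∷ y) = true
precedes (true  ∷ x) (false ∷ y) = false
precedes (true  ∷ x) (true  ∷ y) = precedes x y

precedes-irrefl : ∀ {m} (x : Point m) → precedes x x ≡ false
precedes-irrefl []          = refl
precedes-irrefl (false ∷ x) = precedes-irrefl x
precedes-irrefl (true  ∷ x) = precedes-irrefl x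

precedes-antisym : ∀ {m} (x y : Point m) → x ≢ y → precedes x y ≡ not (precedes y x)
precedes-antisym []          []          x≢y = ⊥-elim (x≢y refl)
precedes-antisym (false ∷ x) (false ∷ y) x≢y = precedes-antisym x y (x≢y ∘ cong (false ∷_))
precedes-antisym (false ∷ x) (true  ∷ y) x≢y = refl
precedes-antisym (true  ∷ x) (false ∷ y) x≢y = refl
precedes-antisym (true  ∷ x) (true  ∷ y) x≢y = precedes-antisym x y (x≢y ∘ cong (true ∷_))

true≢false : ∀ {b} → b ≡ true → b ≡ false → ⊥
true≢false refl ()

precedes⇒≢ : ∀ {m} {x y : Point m} → precedes x y ≡ true → x ≢ y
precedes⇒≢ {x = x} x<y refl = true≢false x<y (precedes-irrefl x)

precedes-asym : ∀ {m} (x y : Point m) → precedes x y ≡ true → precedes y x ≡ false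
precedes-asym x y x<y =
  trans (precedes-antisym y x (≢-sym (precedes⇒≢ x<y))) (cong not x<y)

precedes-total : ∀ {m} {x y : Point m} → x ≢ y → precedes x y ≡ false → precedes y x ≡ true
precedes-total {x = x} {y} x≢y x≮y = trans (precedes-antisym y x (≢-sym x≢y)) (cong not x≮y)

-- The nested system of a balanced assignment

module Nesting {m k ε : ℕ} (S : Assignment m k ε) where
  open Assignment S

  -- The order conditions select one representative ⟨ a , b ∣ c , d ⟩ of each nested block.
  Canonical : NBlock m → Set
  Canonical B = d B ≡ (a B ⊕ b B) ⊕ c B
              × P (a B ⊕ b B) (a B ⊕ c B) ≡ true
              × precedes (a B) (b B) ≡ true
              × precedes (c B) (d B) ≡ true
              × precedes (a B) (c B) ≡ true

  canonical? : Decidable Canonical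
  canonical? B = (d B ≟ₚ _) ×-dec ((_ Bool.≟ true) ×-dec ((_ Bool.≟ true)
                   ×-dec ((_ Bool.≟ true) ×-dec (_ Bool.≟ true))))

  blocks : List (NBlock m)
  blocks = filter canonical? (allBlocks m)

  ∈-blocks⁻ : ∀ {B} → B ∈ blocks → Canonical B
  ∈-blocks⁻ = proj₂ ∘ ∈-filter⁻ canonical? {xs = allBlocks m}

  ∈-blocks⁺ : ∀ {B} → Canonical B → B ∈ blocks
  ∈-blocks⁺ {B} = ∈-filter⁺ canonical? (∈-allBlocks B)

  blocks-unique : Unique blocks
  blocks-unique = Unique.filter⁺ canonical? (allBlocks-unique m)

  canonical-fourSet : ∀ {B} → Canonical B → IsFourSet B
  canonical-fourSet {⟨ x , y ∣ z , _ ⟩} (refl , _ , x<y , z<w , x<z) =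
    precedes⇒≢ x<y , precedes⇒≢ x<z , x≢w , y≢z , y≢w , precedes⇒≢ z<w
    where
    y≢z : y ≢ z
    -- If y = z, the fourth point is x, and the order of the second part would put y before x.
    y≢z refl = true≢false (subst (λ w → precedes y w ≡ true) (⊕-cancelʳ x y) z<w)
                          (precedes-asym x y x<y)
    x≢w : x ≢ (x ⊕ y) ⊕ z
    x≢w eq = y≢z (trans (⊕-solve (x ∷ y ∷ z ∷ []) 𝕓 (((𝕒 :+ 𝕓) :+ 𝕔) :+ (𝕒 :+ 𝕔)) refl)
                  (trans (cong (_⊕ (x ⊕ z)) (sym eq)) (⊕-cancelˡ x z)))
    y≢w : y ≢ (x ⊕ y) ⊕ z
    y≢w eq = precedes⇒≢ x<z (trans (⊕-solve (x ∷ y ∷ z ∷ []) 𝕒 (((𝕒 :+ 𝕓) :+ 𝕔) :+ (𝕓 :+ 𝕔)) refl)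
                  (trans (cong (_⊕ (y ⊕ z)) (sym eq)) (⊕-cancelˡ y z)))

  -- The multiplicity of a pair as the load of its direction

  HasPart : Point m → Point m → NBlock m → Set
  HasPart x y B = SamePair x y (a B) (b B) ⊎ SamePair x y (c B) (d B)

  -- When x precedes y and z precedes its partner x + y + z, this lists the two parts in canonical
  -- order.
  block : Point m → Point m → Point m → NBlock m
  block x y z = if precedes x z then ⟨ x , y ∣ z , (x ⊕ y) ⊕ z ⟩ else ⟨ z , (x ⊕ y) ⊕ z ∣ x , y ⟩

  -- Requiring z to precede its partner counts each second part {z, x + y + z} once.
  good : Point m → Point m → Point m → Bool
  good x y z = P (x ⊕ y) (x ⊕ z) ∧ precedes z ((x ⊕ y) ⊕ z)

  private
    ∧-true : ∀ {b c} → b ∧ c ≡ true → b ≡ true × c ≡ true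
    ∧-true {true} eq = refl , eq

    ∧-intro : ∀ {b c} → b ≡ true → c ≡ true → b ∧ c ≡ true
    ∧-intro refl eq = eq

  block-before : ∀ x y z → precedes x z ≡ true → block x y z ≡ ⟨ x , y ∣ z , (x ⊕ y) ⊕ z ⟩
  block-before x y z eq rewrite eq = refl

  block-after : ∀ x y z → precedes x z ≡ false → block x y z ≡ ⟨ z , (x ⊕ y) ⊕ z ∣ x , y ⟩
  block-after x y z eq rewrite eq = refl

  block-injective : ∀ x y {z w} → block x y z ≡ block x y w → z ≡ w
  block-injective x y {z} {w} eq with precedes x z in x<z | precedes x w in x<w
  ... | true  | true  = cong c eq
  ... | false | false = cong a eq
  ... | true  | false = ⊥-elim (precedes⇒≢ x<z (sym (cong c eq)))
  ... | false | true  = ⊥-elim (precedes⇒≢ x<w (cong c eq))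

  nonzero : ∀ {x y : Point m} → x ≢ y → x ⊕ y ≢ 𝟎
  nonzero {x} {y} x≢y = x≢y ∘ ⊕≡𝟎⇒≡ x y

  -- Both parts of a canonical block are ascending, so x < y leaves only the matches in the given
  -- order; z is then the first point of the other part.
  part⇒block : ∀ {x y B} → precedes x y ≡ true → Canonical B → HasPart x y B →
               ∃[ z ] (good x y z ≡ true × B ≡ block x y z)
  part⇒block {B = ⟨ x , y ∣ z , _ ⟩} x<y (refl , p , _ , z<w , x<z) (inj₁ (inj₁ (refl , refl))) =
    z , ∧-intro p z<w , sym (block-before x y z x<z)
  part⇒block {x} {y} x<y (_ , _ , y<x , _) (inj₁ (inj₂ (refl , refl))) =
    ⊥-elim (true≢false x<y (precedes-asym y x y<x))
  part⇒block {B = ⟨ x , y ∣ z , _ ⟩} _ (refl , p , x<y , z<w , x<z) (inj₂ (inj₁ (refl , refl))) =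
    x , ∧-intro (trans (cong₂ P dir (⊕-comm z x)) p)
                (subst (λ v → precedes x v ≡ true) (sym partner) x<y) ,
    sym (trans (block-after z ((x ⊕ y) ⊕ z) x (precedes-asym x z x<z))
               (cong (λ v → ⟨ x , v ∣ z , (x ⊕ y) ⊕ z ⟩) partner))
    where
    dir : z ⊕ ((x ⊕ y) ⊕ z) ≡ x ⊕ y
    dir = ⊕-solve (x ∷ y ∷ z ∷ []) (𝕔 :+ ((𝕒 :+ 𝕓) :+ 𝕔)) (𝕒 :+ 𝕓) refl
    partner : (z ⊕ ((x ⊕ y) ⊕ z)) ⊕ x ≡ y
    partner = ⊕-solve (x ∷ y ∷ z ∷ []) ((𝕔 :+ ((𝕒 :+ 𝕓) :+ 𝕔)) :+ 𝕒) 𝕓 refl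
  part⇒block {x} {y} x<y (_ , _ , _ , y<x , _) (inj₂ (inj₂ (refl , refl))) =
    ⊥-elim (true≢false x<y (precedes-asym y x y<x))

  block-part : ∀ x y z → HasPart x y (block x y z)
  block-part x y z with precedes x z
  ... | true  = inj₁ (inj₁ (refl , refl))
  ... | false = inj₂ (inj₁ (refl , refl))

  block-canonical : ∀ {x y z} → precedes x y ≡ true → good x y z ≡ true → Canonical (block x y z)
  block-canonical {x} {y} {z} x<y g with ∧-true {P (x ⊕ y) (x ⊕ z)} g | precedes x z in x<z
  ... | p , z<w | true  = refl , p , x<y , z<w , x<z
  ... | p , z<w | false =
    ⊕-solve (x ∷ y ∷ z ∷ []) 𝕓 ((𝕔 :+ ((𝕒 :+ 𝕓) :+ 𝕔)) :+ 𝕒) refl ,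
    trans (cong₂ P (⊕-solve (x ∷ y ∷ z ∷ []) (𝕔 :+ ((𝕒 :+ 𝕓) :+ 𝕔)) (𝕒 :+ 𝕓) refl) (⊕-comm z x)) p ,
    z<w , x<y , precedes-total x≢z x<z
    where
    x≢z : x ≢ z
    x≢z refl = true≢false p (trans (cong (P (x ⊕ y)) (⊕-self x)) (P-𝟎 (x ⊕ y) (nonzero (precedes⇒≢ x<y))))

  -- `block x y` is a bijection from the good z onto the blocks with part {x, y}.
  multiplicity-ordered : ∀ {x y} → precedes x y ≡ true → multiplicity blocks x y ≡ count (good x y)
  multiplicity-ordered {x} {y} x<y =
    trans (length-≡ (Unique.filter⁺ (hasPart? x y) blocks-unique)
                    (Unique.map⁺ (block-injective x y) (Unique.filter⁺ good? (allPoints-unique m)))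
                    (mk⇔ to from))
    (trans (length-map (block x y) (filter good? (allPoints m)))
           (length-filter-allPoints (good x y)))
    where
    good? : Decidable (λ z → good x y z ≡ true)
    good? z = good x y z Bool.≟ true
    to : ∀ {B} → B ∈ filter (hasPart? x y) blocks → B ∈ map (block x y) (filter good? (allPoints m))
    to B∈ with ∈-filter⁻ (hasPart? x y) {xs = blocks} B∈
    ... | B∈blocks , part with part⇒block x<y (∈-blocks⁻ B∈blocks) part
    ... | z , g , refl = ∈-map⁺ (block x y) (∈-filter⁺ good? (∈-allPoints z) g)
    from : ∀ {B} → B ∈ map (block x y) (filter good? (allPoints m)) → B ∈ filter (hasPart? x y) blocks
    from B∈ with ∈-map⁻ (block x y) B∈
    ... | z , z∈ , refl = ∈-filter⁺ (hasPart? x y)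
      (∈-blocks⁺ (block-canonical x<y (proj₂ (∈-filter⁻ good? {xs = allPoints m} z∈)))) (block-part x y z)

  -- Translation by x ⊕ y exchanges the z that precede their partner with those that do not.
  count-good : ∀ {x y} → x ≢ y → count (good x y) + count (good x y) ≡ count (P (x ⊕ y))
  count-good {x} {y} x≢y =
    trans (cong (count (good x y) +_)
            (trans (sym (count-translate (x ⊕ y) (good x y))) (count-cong mirror)))
    (trans (count-split (λ z → P (x ⊕ y) (x ⊕ z)) (λ z → precedes z ((x ⊕ y) ⊕ z)))
           (count-translate x (P (x ⊕ y))))
    where
    mirror : ∀ z → good x y ((x ⊕ y) ⊕ z) ≡ P (x ⊕ y) (x ⊕ z) ∧ not (precedes z ((x ⊕ y) ⊕ z))
    mirror z = cong₂ _∧_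
      (trans (cong (P (x ⊕ y)) (⊕-solve (x ∷ y ∷ z ∷ []) (𝕒 :+ ((𝕒 :+ 𝕓) :+ 𝕔)) ((𝕒 :+ 𝕓) :+ (𝕒 :+ 𝕔)) refl))
             (P-shift (x ⊕ y) (x ⊕ z)))
      (trans (cong (precedes ((x ⊕ y) ⊕ z)) (⊕-cancelˡ (x ⊕ y) z))
             (precedes-antisym ((x ⊕ y) ⊕ z) z λ eq → nonzero x≢y
               (trans (sym (⊕-cancelʳ (x ⊕ y) z))
                      (trans (cong (_⊕ z) eq) (⊕-self z)))))

  private
    samePair-swap : ∀ {x y u v : Point m} → SamePair x y u v → SamePair y x u v
    samePair-swap (inj₁ (p , q)) = inj₂ (q , p)
    samePair-swap (inj₂ (p , q)) = inj₁ (q , p)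

    hasPart-swap : ∀ {x y B} → HasPart x y B → HasPart y x B
    hasPart-swap (inj₁ p) = inj₁ (samePair-swap p)
    hasPart-swap (inj₂ p) = inj₂ (samePair-swap p)

  multiplicity-swap : ∀ x y → multiplicity blocks x y ≡ multiplicity blocks y x
  multiplicity-swap x y = cong length
    (filter-≐ (hasPart? x y) (hasPart? y x) (hasPart-swap , hasPart-swap) blocks)

  multiplicity-double : ∀ {x y} → x ≢ y →
    multiplicity blocks x y + multiplicity blocks x y ≡ count (P (x ⊕ y))
  multiplicity-double {x} {y} x≢y with precedes x y in x<y
  ... | true  = trans (cong₂ _+_ (multiplicity-ordered x<y) (multiplicity-ordered x<y)) (count-good x≢y)
  ... | false = trans (cong₂ _+_ eq eq) (trans (count-good (≢-sym x≢y)) (cong (count ∘ P) (⊕-comm y x)))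
    where eq = trans (multiplicity-swap x y) (multiplicity-ordered (precedes-total x≢y x<y))

  -- Each triple of points lies in exactly one block

  private
    choose-unique : ∀ {p q} → P p q ≡ true → p ≢ 𝟎 → q ≢ 𝟎 → p ≢ q →
                    P q p ≡ false × P (p ⊕ q) p ≡ false
    choose-unique {p} {q} pq p≢𝟎 q≢𝟎 p≢q
      with P p q | P q p | P (p ⊕ q) p | pq | P-exact p q p≢𝟎 q≢𝟎 p≢q
    ... | true | false | false | _ | _ = refl , refl

    span : Point m → Point m → Bool → Bool → Point m
    span p q α β = (α · p) ⊕ (β · q)

    P-self : ∀ p → p ≢ 𝟎 → P p p ≡ false
    P-self p p≢𝟎 = trans (cong (P p) (sym (⊕-identityʳ p))) (trans (P-shift p 𝟎) (P-𝟎 p p≢𝟎))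

  -- If the line through p and q is assigned to p, neither q nor p + q is chosen in their plane. The
  -- direction 0 is left open, as `P-𝟎` does not speak of it; `chosen-part` excludes it by x ≢ y.
  chosen-coefficient : ∀ {p q} → P p q ≡ true → p ≢ 𝟎 → q ≢ 𝟎 → p ≢ q → ∀ α β γ δ →
    P (span p q α β) (span p q γ δ) ≡ true → β ≡ false
  chosen-coefficient pq p≢𝟎 q≢𝟎 p≢q α false γ δ _ = refl
  chosen-coefficient {p} {q} pq p≢𝟎 q≢𝟎 p≢q false true γ δ eq =
    ⊥-elim (true≢false eq (trans (cong (λ u → P u (span p q γ δ)) (⊕-identityˡ q)) (no-q γ δ)))
    where
    Pqp = proj₁ (choose-unique pq p≢𝟎 q≢𝟎 p≢q)
    no-q : ∀ γ δ → P q (span p q γ δ) ≡ false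
    no-q true  true  = trans (cong (P q) (⊕-comm p q)) (trans (P-shift q p) Pqp)
    no-q true  false = trans (cong (P q) (⊕-identityʳ p)) Pqp
    no-q false true  = trans (cong (P q) (⊕-identityˡ q)) (P-self q q≢𝟎)
    no-q false false = trans (cong (P q) (⊕-identityˡ 𝟎)) (P-𝟎 q q≢𝟎)
  chosen-coefficient {p} {q} pq p≢𝟎 q≢𝟎 p≢q true true γ δ eq = ⊥-elim (true≢false eq (no-sum γ δ))
    where
    P+p = proj₂ (choose-unique pq p≢𝟎 q≢𝟎 p≢q)
    no-sum : ∀ γ δ → P (p ⊕ q) (span p q γ δ) ≡ false
    no-sum true  true  = P-self (p ⊕ q) (nonzero p≢q)
    no-sum true  false = trans (cong (P (p ⊕ q)) (⊕-identityʳ p)) P+p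
    no-sum false true  = trans (cong (P (p ⊕ q)) (⊕-solve (p ∷ q ∷ []) (:0 :+ 𝕓) ((𝕒 :+ 𝕓) :+ 𝕒) refl))
                               (trans (P-shift (p ⊕ q) p) P+p)
    no-sum false false = trans (cong (P (p ⊕ q)) (⊕-identityˡ 𝟎)) (P-𝟎 (p ⊕ q) (nonzero p≢q))

  coordinates : ∀ {B x} → Canonical B → x ∈B B →
    ∃[ α ] ∃[ β ] x ≡ a B ⊕ span (a B ⊕ b B) (a B ⊕ c B) α β
  coordinates {⟨ x , y ∣ z , _ ⟩} (refl , _) (inj₁ refl) =
    false , false , ⊕-solve (x ∷ []) 𝕒 (𝕒 :+ (:0 :+ :0)) refl
  coordinates {⟨ x , y ∣ z , _ ⟩} (refl , _) (inj₂ (inj₁ refl)) =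
    true , false , ⊕-solve (x ∷ y ∷ []) 𝕓 (𝕒 :+ ((𝕒 :+ 𝕓) :+ :0)) refl
  coordinates {⟨ x , y ∣ z , _ ⟩} (refl , _) (inj₂ (inj₂ (inj₁ refl))) =
    false , true , ⊕-solve (x ∷ z ∷ []) 𝕓 (𝕒 :+ (:0 :+ (𝕒 :+ 𝕓))) refl
  coordinates {⟨ x , y ∣ z , _ ⟩} (refl , _) (inj₂ (inj₂ (inj₂ refl))) =
    true , true , ⊕-solve (x ∷ y ∷ z ∷ []) ((𝕒 :+ 𝕓) :+ 𝕔) (𝕒 :+ ((𝕒 :+ 𝕓) :+ (𝕒 :+ 𝕔))) refl

  private
    span-difference : ∀ x p q α β γ δ →
      (x ⊕ span p q α β) ⊕ (x ⊕ span p q γ δ) ≡ span p q (α xor γ) (β xor δ)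
    span-difference x p q α β γ δ = trans
      (⊕-solve (x ∷ span p q α β ∷ span p q γ δ ∷ []) ((𝕒 :+ 𝕓) :+ (𝕒 :+ 𝕔)) (𝕓 :+ 𝕔) refl)
      (trans (⊕-interchange (α · p) (β · q) (γ · p) (δ · q))
             (sym (cong₂ _⊕_ (·-distrib-xor α γ p) (·-distrib-xor β δ q))))

    xor≡false : ∀ {β δ} → β xor δ ≡ false → β ≡ δ
    xor≡false {true}  {true}  _ = refl
    xor≡false {false} {false} _ = refl

  -- In affine coordinates on the plane of B, with directions p = a + b and q = a + c, the chosen
  -- direction x + y has no q-component. So x and y agree in the q-coordinate, whose two values
  -- separate the parts.
  chosen-part : ∀ {B x y z} → Canonical B → x ∈B B → y ∈B B → z ∈B B → x ≢ y →
                P (x ⊕ y) (x ⊕ z) ≡ true → HasPart x y B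
  chosen-part {B@(⟨ o , s ∣ t , r ⟩)} {x} {y} {z} Q@(eq , pq , o<s , _ , o<t) x∈ y∈ z∈ x≢y pxy
    with coordinates {B} Q x∈ | coordinates {B} Q y∈ | coordinates {B} Q z∈
  ... | α , β , refl | γ , δ , refl | ζ , η , refl
    with xor≡false {β} {δ} (chosen-coefficient pq
           (nonzero (precedes⇒≢ o<s)) (nonzero (precedes⇒≢ o<t)) p≢q
           (α xor γ) (β xor δ) (α xor ζ) (β xor η)
           (trans (cong₂ P (sym (span-difference o p q α β γ δ))
                           (sym (span-difference o p q α β ζ η))) pxy))
    where
    p = o ⊕ s
    q = o ⊕ t
    p≢q : p ≢ q
    p≢q p≡q = proj₁ (proj₂ (proj₂ (proj₂ (canonical-fourSet {B} Q))))
      (trans (sym (⊕-cancelˡ o s)) (trans (cong (o ⊕_) p≡q) (⊕-cancelˡ o t)))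
  ... | refl = part α β γ x≢y
    where
    p = o ⊕ s
    q = o ⊕ t
    o≡ : o ⊕ span p q false false ≡ o
    o≡ = ⊕-solve (o ∷ []) (𝕒 :+ (:0 :+ :0)) 𝕒 refl
    s≡ : o ⊕ span p q true false ≡ s
    s≡ = ⊕-solve (o ∷ s ∷ []) (𝕒 :+ ((𝕒 :+ 𝕓) :+ :0)) 𝕓 refl
    t≡ : o ⊕ span p q false true ≡ t
    t≡ = ⊕-solve (o ∷ t ∷ []) (𝕒 :+ (:0 :+ (𝕒 :+ 𝕓))) 𝕓 refl
    r≡ : o ⊕ span p q true true ≡ r
    r≡ = trans (⊕-solve (o ∷ s ∷ t ∷ []) (𝕒 :+ ((𝕒 :+ 𝕓) :+ (𝕒 :+ 𝕔))) ((𝕒 :+ 𝕓) :+ 𝕔) refl) (sym eq)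
    part : ∀ α β γ → o ⊕ span p q α β ≢ o ⊕ span p q γ β →
           HasPart (o ⊕ span p q α β) (o ⊕ span p q γ β) B
    part true  _     true  x≢y = ⊥-elim (x≢y refl)
    part false _     false x≢y = ⊥-elim (x≢y refl)
    part false false true  _   = inj₁ (inj₁ (o≡ , s≡))
    part true  false false _   = inj₁ (inj₂ (s≡ , o≡))
    part false true  true  _   = inj₂ (inj₁ (t≡ , r≡))
    part true  true  false _   = inj₂ (inj₂ (r≡ , t≡))

  -- Uniqueness, existence and the point set are bundled so that they are transported together when
  -- x, y, z are permuted.
  UniqueBlock : Point m → Point m → Point m → Set
  UniqueBlock x y z = ∃[ B₀ ]
    ( (∀ B → Canonical B → x ∈B B → y ∈B B → z ∈B B → B ≡ B₀)
    × Canonical B₀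
    × SameSet B₀ x y z ((x ⊕ y) ⊕ z) )

  private
    perm₃ : ∀ {w p q r s : Point m} → w ≡ p ⊎ w ≡ q ⊎ w ≡ r ⊎ w ≡ s → w ≡ r ⊎ w ≡ s ⊎ w ≡ p ⊎ w ≡ q
    perm₃ (inj₁ e)               = inj₂ (inj₂ (inj₁ e))
    perm₃ (inj₂ (inj₁ e))        = inj₂ (inj₂ (inj₂ e))
    perm₃ (inj₂ (inj₂ (inj₁ e))) = inj₁ e
    perm₃ (inj₂ (inj₂ (inj₂ e))) = inj₂ (inj₁ e)

    perm₁ : ∀ {w p q r s : Point m} → w ≡ p ⊎ w ≡ q ⊎ w ≡ r ⊎ w ≡ s → w ≡ q ⊎ w ≡ p ⊎ w ≡ r ⊎ w ≡ s
    perm₁ (inj₁ e)        = inj₂ (inj₁ e)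
    perm₁ (inj₂ (inj₁ e)) = inj₁ e
    perm₁ (inj₂ (inj₂ e)) = inj₂ (inj₂ e)

    perm₂ : ∀ {w p q r s : Point m} → w ≡ p ⊎ w ≡ q ⊎ w ≡ r ⊎ w ≡ s → w ≡ p ⊎ w ≡ r ⊎ w ≡ q ⊎ w ≡ s
    perm₂ (inj₁ e) = inj₁ e
    perm₂ (inj₂ e) = inj₂ (perm e)
      where
      perm : ∀ {w q r s : Point m} → w ≡ q ⊎ w ≡ r ⊎ w ≡ s → w ≡ r ⊎ w ≡ q ⊎ w ≡ s
      perm (inj₁ e)        = inj₂ (inj₁ e)
      perm (inj₂ (inj₁ e)) = inj₁ e
      perm (inj₂ (inj₂ e)) = inj₂ (inj₂ e)

    perm₄ : ∀ {w p q r s : Point m} → w ≡ p ⊎ w ≡ q ⊎ w ≡ r ⊎ w ≡ s → w ≡ p ⊎ w ≡ q ⊎ w ≡ s ⊎ w ≡ r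
    perm₄ (inj₁ e)        = inj₁ e
    perm₄ (inj₂ (inj₁ e)) = inj₂ (inj₁ e)
    perm₄ (inj₂ (inj₂ e)) = inj₂ (inj₂ (swap e))

  swap₁₂ : ∀ {x y z} → UniqueBlock x y z → UniqueBlock y x z
  swap₁₂ {x} {y} {z} (B₀ , only , canonical , same) =
    B₀ , (λ B Q y∈ x∈ z∈ → only B Q x∈ y∈ z∈) , canonical ,
    λ w → subst (λ v → w ∈B B₀ ⇔ (w ≡ y ⊎ w ≡ x ⊎ w ≡ z ⊎ w ≡ v)) (cong (_⊕ z) (⊕-comm x y))
      (mk⇔ (perm₁ ∘ Equivalence.to (same w)) (Equivalence.from (same w) ∘ perm₁))

  swap₂₃ : ∀ {x y z} → UniqueBlock x y z → UniqueBlock x z y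
  swap₂₃ {x} {y} {z} (B₀ , only , canonical , same) =
    B₀ , (λ B Q x∈ z∈ y∈ → only B Q x∈ y∈ z∈) , canonical ,
    λ w → subst (λ v → w ∈B B₀ ⇔ (w ≡ x ⊎ w ≡ z ⊎ w ≡ y ⊎ w ≡ v))
                (⊕-solve (x ∷ y ∷ z ∷ []) ((𝕒 :+ 𝕓) :+ 𝕔) ((𝕒 :+ 𝕔) :+ 𝕓) refl)
      (mk⇔ (perm₂ ∘ Equivalence.to (same w)) (Equivalence.from (same w) ∘ perm₂))

  block-members : ∀ x y z → SameSet (block x y z) x y z ((x ⊕ y) ⊕ z)
  block-members x y z w with precedes x z
  ... | true  = mk⇔ (λ e → e) (λ e → e)
  ... | false = mk⇔ perm₃ perm₃

  -- The other part is {z, v}, and the parameter of `block x y` is whichever of z and v comes first.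
  block-is : ∀ {B x y z v} → precedes x y ≡ true → Canonical B → HasPart x y B → z ∈B B →
             x ≢ z → y ≢ z → v ≡ (x ⊕ y) ⊕ z →
             (precedes z v ≡ true × B ≡ block x y z) ⊎ (precedes z v ≡ false × B ≡ block x y v)
  block-is {x = x} {y} {z} x<y Q part z∈ x≢z y≢z refl with part⇒block x<y Q part
  ... | u , g , refl with Equivalence.to (block-members x y u z) z∈
  ... | inj₁ z≡x        = ⊥-elim (x≢z (sym z≡x))
  ... | inj₂ (inj₁ z≡y) = ⊥-elim (y≢z (sym z≡y))
  ... | inj₂ (inj₂ (inj₁ refl)) = inj₁ (proj₂ (∧-true {P (x ⊕ y) (x ⊕ z)} g) , refl)
  ... | inj₂ (inj₂ (inj₂ refl)) rewrite ⊕-cancelˡ (x ⊕ y) u =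
    inj₂ (precedes-asym u _ (proj₂ (∧-true {P (x ⊕ y) (x ⊕ u)} g)) , refl)

  -- By `chosen-part` every block through the three points has {x, y} as a part, and then `block-is`
  -- determines it.
  unique-ordered : ∀ {x y z} → Distinct3 x y z → precedes x y ≡ true → P (x ⊕ y) (x ⊕ z) ≡ true →
                   UniqueBlock x y z
  unique-ordered {x} {y} {z} (x≢y , x≢z , y≢z) x<y p with precedes z ((x ⊕ y) ⊕ z) in z<v
  ... | true  = block x y z , only , block-canonical x<y (∧-intro p z<v) , block-members x y z
    where
    only : ∀ B → Canonical B → x ∈B B → y ∈B B → z ∈B B → B ≡ block x y z
    only B Q x∈ y∈ z∈ with block-is {B} x<y Q (chosen-part {B} Q x∈ y∈ z∈ x≢y p) z∈ x≢z y≢z refl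
    ... | inj₁ (_ , eq)   = eq
    ... | inj₂ (z≮v , _)  = ⊥-elim (true≢false z<v z≮v)
  ... | false = block x y v , only , block-canonical x<y (∧-intro pv v<z) , members
    where
    v = (x ⊕ y) ⊕ z
    v-partner : (x ⊕ y) ⊕ v ≡ z
    v-partner = ⊕-cancelˡ (x ⊕ y) z
    z≢v : z ≢ v
    z≢v eq = nonzero x≢y (trans (sym (⊕-cancelʳ (x ⊕ y) z))
                                (trans (cong (_⊕ z) (sym eq)) (⊕-self z)))
    v<z : precedes v ((x ⊕ y) ⊕ v) ≡ true
    v<z = trans (cong (precedes v) v-partner) (precedes-total z≢v z<v)
    pv : P (x ⊕ y) (x ⊕ v) ≡ true
    pv = trans (cong (P (x ⊕ y)) (⊕-solve (x ∷ y ∷ z ∷ []) (𝕒 :+ ((𝕒 :+ 𝕓) :+ 𝕔)) ((𝕒 :+ 𝕓) :+ (𝕒 :+ 𝕔)) refl))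
               (trans (P-shift (x ⊕ y) (x ⊕ z)) p)
    only : ∀ B → Canonical B → x ∈B B → y ∈B B → z ∈B B → B ≡ block x y v
    only B Q x∈ y∈ z∈ with block-is {B} x<y Q (chosen-part {B} Q x∈ y∈ z∈ x≢y p) z∈ x≢z y≢z refl
    ... | inj₁ (z<v′ , _) = ⊥-elim (true≢false z<v′ z<v)
    ... | inj₂ (_ , eq)   = eq
    members : SameSet (block x y v) x y z v
    members w = subst (λ u → w ∈B block x y v ⇔ (w ≡ x ⊎ w ≡ y ⊎ w ≡ u ⊎ w ≡ v)) v-partner
      (mk⇔ (perm₄ ∘ Equivalence.to (block-members x y v w)) (Equivalence.from (block-members x y v w) ∘ perm₄))

  unique-chosen : ∀ {x y z} → Distinct3 x y z → P (x ⊕ y) (x ⊕ z) ≡ true → UniqueBlock x y z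
  unique-chosen {x} {y} {z} D@(x≢y , x≢z , y≢z) p with precedes x y in x<y
  ... | true  = unique-ordered D x<y p
  ... | false = swap₁₂ (unique-ordered (≢-sym x≢y , y≢z , x≢z) (precedes-total x≢y x<y)
    (trans (cong₂ P (⊕-comm y x) (⊕-solve (x ∷ y ∷ z ∷ []) (𝕓 :+ 𝕔) ((𝕒 :+ 𝕓) :+ (𝕒 :+ 𝕔)) refl))
           (trans (P-shift (x ⊕ y) (x ⊕ z)) p)))

  -- One of the directions x + y, x + z and (x + y) + (x + z) = y + z holds their line; a
  -- permutation of the points moves it to the place of x + y.
  uniqueBlock : ∀ {x y z} → Distinct3 x y z → UniqueBlock x y z
  uniqueBlock {x} {y} {z} D@(x≢y , x≢z , y≢z)
    with P (x ⊕ y) (x ⊕ z) in p₁ | P (x ⊕ z) (x ⊕ y) in p₂ | P ((x ⊕ y) ⊕ (x ⊕ z)) (x ⊕ y) in p₃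
       | P-exact (x ⊕ y) (x ⊕ z) (nonzero x≢y) (nonzero x≢z) directions-differ
    where
    directions-differ : x ⊕ y ≢ x ⊕ z
    directions-differ eq = y≢z (trans (sym (⊕-cancelˡ x y)) (trans (cong (x ⊕_) eq) (⊕-cancelˡ x z)))
  ... | true  | _     | _    | _ = unique-chosen D p₁
  ... | false | true  | _    | _ = swap₂₃ (unique-chosen (x≢z , x≢y , ≢-sym y≢z) p₂)
  ... | false | false | true | _ = swap₁₂ (swap₂₃ (unique-chosen (y≢z , ≢-sym x≢y , ≢-sym x≢z)
    (trans (cong₂ P (⊕-solve (x ∷ y ∷ z ∷ []) (𝕓 :+ 𝕔) ((𝕒 :+ 𝕓) :+ (𝕒 :+ 𝕔)) refl) (⊕-comm y x)) p₃)))

  nestedSQS : IsNestedSQS blocks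
  nestedSQS = (λ B B∈ → canonical-fourSet {B} (∈-blocks⁻ B∈)) , one-block
    where
    one-block : ∀ x y z → Distinct3 x y z → length (filter (contains3? x y z) blocks) ≡ 1
    one-block x y z D with uniqueBlock D
    ... | B₀ , only , canonical , same =
      length-≡ (Unique.filter⁺ (contains3? x y z) blocks-unique) ([] ∷ []) (mk⇔ to from)
      where
      to : ∀ {B} → B ∈ filter (contains3? x y z) blocks → B ∈ B₀ ∷ []
      to {B} B∈ with ∈-filter⁻ (contains3? x y z) {xs = blocks} B∈
      ... | B∈blocks , x∈ , y∈ , z∈ = here (only B (∈-blocks⁻ B∈blocks) x∈ y∈ z∈)
      from : ∀ {B} → B ∈ B₀ ∷ [] → B ∈ filter (contains3? x y z) blocks
      from (here refl) = ∈-filter⁺ (contains3? x y z) (∈-blocks⁺ canonical)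
        ( Equivalence.from (same x) (inj₁ refl)
        , Equivalence.from (same y) (inj₂ (inj₁ refl))
        , Equivalence.from (same z) (inj₂ (inj₂ (inj₁ refl))) )

  underlying : UnderlyingIsBoolean blocks
  underlying = boolean , λ x y z D → let (B₀ , _ , canonical , same) = uniqueBlock D in
                                      B₀ , ∈-blocks⁺ canonical , same
    where
    boolean : ∀ B → B ∈ blocks →
              ∃[ x ] ∃[ y ] ∃[ z ] (Distinct3 x y z × SameSet B x y z ((x ⊕ y) ⊕ z))
    boolean B B∈ with ∈-blocks⁻ B∈
    ... | Q@(refl , _) with canonical-fourSet {B} Q
    ... | a≢b , a≢c , _ , b≢c , _ = a B , b B , c B , (a≢b , a≢c , b≢c) , λ w → mk⇔ (λ e → e) (λ e → e)

  -- Bounds on the multiplicities and uniformity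

  private
    half-≤ : ∀ {u v} → u + u ≤ v + v → u ≤ v
    half-≤ {u} {v} u+u≤v+v with u ≤? v
    ... | yes u≤v = u≤v
    ... | no  u≰v = ⊥-elim (<⇒≱ (+-mono-< (≰⇒> u≰v) (≰⇒> u≰v)) u+u≤v+v)

  multiplicity-lower : ∀ {x y} → x ≢ y → k ≤ multiplicity blocks x y
  multiplicity-lower x≢y =
    half-≤ (≤-trans (P-lower _ (nonzero x≢y)) (≤-reflexive (sym (multiplicity-double x≢y))))

  multiplicity-upper : ∀ {x y} → x ≢ y → multiplicity blocks x y ≤ k + ε
  multiplicity-upper x≢y =
    half-≤ (≤-trans (≤-reflexive (multiplicity-double x≢y)) (P-upper _ (nonzero x≢y)))

  multiplicity-attained : ∀ {n} → ∃[ p ] (p ≢ 𝟎 × count (P p) ≡ n + n) →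
                          ∃[ x ] ∃[ y ] (x ≢ y × multiplicity blocks x y ≡ n)
  -- The pair {0, p} has direction p.
  multiplicity-attained (p , p≢𝟎 , eq) = 𝟎 , p , ≢-sym p≢𝟎 ,
    ≤-antisym (half-≤ (≤-reflexive double)) (half-≤ (≤-reflexive (sym double)))
    where double = trans (multiplicity-double (≢-sym p≢𝟎)) (trans (cong (count ∘ P) (⊕-identityˡ p)) eq)

uniform : ∀ {m k} (S : Assignment m k 0) → 1 ≤ k → CompletelyUniform (Nesting.blocks S)
uniform {k = k} S 1≤k = k , 1≤k , λ x y x≢y →
  ≤-antisym (≤-trans (multiplicity-upper x≢y) (≤-reflexive (+-identityʳ k))) (multiplicity-lower x≢y)
  where open Nesting S

quasiUniform : ∀ {m k} (S : Assignment m k 1) → 1 ≤ k → CompletelyQuasiUniform (Nesting.blocks S)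
quasiUniform {k = k} S 1≤k =
  (λ x y x≢y → ≤-trans 1≤k (multiplicity-lower x≢y)) ,
  (λ x y u v x≢y u≢v → ≤-trans (multiplicity-upper x≢y)
    (≤-trans (≤-reflexive (+-comm k 1)) (s≤s (multiplicity-lower u≢v)))) ,
  differ
  where
  open Nesting S
  differ : ∃[ x ] ∃[ y ] ∃[ u ] ∃[ v ] (x ≢ y × u ≢ v × multiplicity blocks x y ≢ multiplicity blocks u v)
  differ with multiplicity-attained {k} (Assignment.P-min S) | multiplicity-attained {k + 1} (Assignment.P-max S)
  ... | x , y , x≢y , low | u , v , u≢v , high =
    x , y , u , v , x≢y , u≢v , λ eq →
    1+n≢n (trans (+-comm 1 k) (trans (sym high) (trans (sym eq) low)))

-- From dimension 3 on, half of the space has at least 4 points, whereas k = 0 would leave 1 + ε ≤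
-- 2.
load-positive : ∀ m {k ε} → ε ≤ 1 → size (2 + m) ≡ suc (k + k + k + ε) → 1 ≤ k
load-positive _ {suc k} _ _ = s≤s z≤n
load-positive m {zero} {ε} ε≤1 eq = ⊥-elim (<⇒≱ (s≤s (s≤s (s≤s z≤n))) (begin
  4            ≤⟨ +-mono-≤ 2≤ 2≤ ⟩
  size (2 + m) ≡⟨ eq ⟩
  suc ε        ≤⟨ s≤s ε≤1 ⟩
  2            ∎))
  where
  open ≤-Reasoning
  2≤ : 2 ≤ size (suc m)
  2≤ = +-mono-≤ (size-positive m) (size-positive m)

parity : ∀ m → m % 2 ≡ 0 ⊎ m % 2 ≡ 1
parity zero          = inj₁ refl
parity (suc zero)    = inj₂ refl
parity (suc (suc m)) = parity m

theorem4p8 : ∀ (m : ℕ) → 3 ≤ m →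
    ∃[ 𝓑 ] (IsNestedSQS {m} 𝓑 × UnderlyingIsBoolean 𝓑
    × (m % 2 ≡ 1 → CompletelyUniform 𝓑)
    × (m % 2 ≡ 0 → CompletelyQuasiUniform 𝓑))
-- The dimension 3 + m has the parity of 1 + m, the argument that the recursion takes for it.
theorem4p8 (suc (suc (suc m))) (s≤s (s≤s (s≤s _))) with parity (suc m)
... | inj₁ even = blocks , nestedSQS , underlying ,
      (λ odd → ⊥-elim (0≢1+n (trans (sym even) odd))) ,
      (λ _ → quasiUniform assignment (load-positive m ≤-refl size-eq))
  where
  open Balanced (balanced-even (suc m) even)
  open Nesting assignment
... | inj₂ odd = blocks , nestedSQS , underlying ,
      (λ _ → uniform assignment (load-positive m z≤n size-eq)) ,
      (λ even → ⊥-elim (0≢1+n (trans (sym even) odd)))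
  where
  open Balanced (balanced-odd (suc m) odd)
  open Nesting assignment
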